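{- Let $\mathcal{D}$ be a $2-(v,k,1)$ design with $k\geq4$, let $r=\frac{v-1}{k-1}$, and let $\mathcal{S}$ be an Erdős-Ko-Rado set on $\mathcal{D}$. If $k^{2}-k\geq r\geq k^{2}-3k+\frac{3}{4}\sqrt{k}+2$, then $|\mathcal{S}|\leq r$. If moreover $(r,k)\neq(8,4)$, then equality $|\mathcal{S}|=r$ is obtained if and only if $\mathcal{S}$ is a point-pencil.
   Context: A $2-(v,k,1)$ design, with integers $v>k>1$, consists of a set $\mathcal{P}$ of $v$ points together with a set $\mathcal{B}$ of $k$-subsets of $\mathcal{P}$ (blocks) such that any two distinct points are contained in exactly one block. Every point then lies on exactly $r=\frac{v-1}{k-1}$ blocks. An Erdős-Ko-Rado set on a design is a set of pairwise intersecting blocks. A point-pencil is the set of all blocks through a fixed point. -}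

module Defs where

open import Data.Fin.Base using (Fin)
open import Data.Fin.Subset using (Subset; _∈_; _∩_; ∣_∣; Nonempty)
open import Data.Integer.Base using (+_)
open import Data.Nat.Base using (ℕ; _<_; _∸_; >-nonZero)
open import Data.Nat.Properties using (m<n⇒0<n∸m)
open import Data.Product using (_×_; ∃; ∃!)
open import Data.Rational.Base using (ℚ; 0ℚ; _/_; _*_; _≤_)
open import Data.Rational.Literals using (fromℤ)
open import Function.Bundles using (_⇔_)
open import Function.Definitions using (Injective)
open import Relation.Binary.PropositionalEquality using (_≡_; _≢_)

fromℕ : ℕ → ℚ
fromℕ n = fromℤ (+ n)

-- The set of blocks is given by a repetition-free enumeration of its
-- members, so that a set of blocks is a Subset b.
record Design (v k : ℕ) : Set where
  field
    1<k             : 1 < k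
    k<v             : k < v
    b               : ℕ
    block           : Fin b → Subset v
    block-injective : Injective _≡_ _≡_ block
    block-size      : ∀ B → ∣ block B ∣ ≡ k
    joining-block   : ∀ {p q} → p ≢ q →
                      ∃! _≡_ λ B → p ∈ block B × q ∈ block B

  r : ℚ
  r = (+ (v ∸ 1) / (k ∸ 1)) {{>-nonZero (m<n⇒0<n∸m 1<k)}}

  IsErdősKoRado : Subset b → Set
  IsErdősKoRado S = ∀ {B C} → B ∈ S → C ∈ S → Nonempty (block B ∩ block C)

  IsPointPencil : Subset b → Set
  IsPointPencil S = ∃ λ p → ∀ B → B ∈ S ⇔ p ∈ block B

infix 4 _≥√_

-- s ≥ √n for a rational s.
--
-- Let f be linear with rational coefficients and positive slope, and let
-- x be rational.  Then the real inequality x ≥ f(√n) holds if and only if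
-- x ≥ f(s) for some rational s ≥ √n: f is increasing, and s can be taken
-- to be the rational number with f(s) = x.
_≥√_ : ℚ → ℕ → Set
s ≥√ n = 0ℚ ≤ s × fromℕ n ≤ s * s

{-# OPTIONS --safe #-}
module Submission where

-- Let K = k - 1 and let d p be the number of blocks of S through p.  If a set
-- of w points contains every block of S and t is the size of its intersection
-- with a block, then (t - 1) (t - 2) ≥ 0 on all blocks and equals
-- (k - 1) (k - 2) on the blocks of S; summing over all blocks bounds |S| in
-- terms of w, k and r.  Suppose S is not contained in a pencil and |S| ≥ r.
-- Then d p ≤ k for every p.
--
-- If d p = k for some p, the k blocks of S through p cover a set of k K + 1
-- points which contains every block of S, and the bound leaves only r = 8,
-- k = 4, |S| = r.
--
-- If d p ≤ K everywhere, write |S| = K (K - 1) + δ.  The sum of K - d p over a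
-- block of S is K - δ, so δ ≤ d p ≤ K on the support of S, and summing
-- (d p - δ) (K - d p) ≥ 0 bounds the size of the support by |S| + |S| / δ.
-- The bound then becomes δ² (2 K + 1 - δ) ≤ K (K + 1), which is impossible
-- for (3/4) √k ≤ δ ≤ K.

module Arithmetic where
  open import Data.Empty using (⊥; ⊥-elim)
  open import Data.Integer.Base hiding (suc; pred; ∣_∣)
  open import Data.Integer.Properties
  open import Data.Integer.Tactic.RingSolver using (solve-∀)
  open import Data.Nat.Base as ℕ using (ℕ; z≤n)
  open import Data.Product using (_×_; _,_)
  open import Data.Sum.Base using (_⊎_; inj₁; inj₂; [_,_]′)
  open import Relation.Binary.PropositionalEquality
  open import Relation.Nullary using (yes; no)

  infixl 6 _⊹_
  infixl 7 _·_

  _⊹_ : ∀ {x y} → 0ℤ ≤ x → 0ℤ ≤ y → 0ℤ ≤ x + y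
  _⊹_ = +-mono-≤

  _·_ : ∀ {x y} → 0ℤ ≤ x → 0ℤ ≤ y → 0ℤ ≤ x * y
  _·_ {+ m} {+ n} _ _ = subst (0ℤ ≤_) (pos-* m n) (+≤+ z≤n)

  lit : ∀ {n} → 0ℤ ≤ + n
  lit = +≤+ z≤n

  square≥0 : ∀ x → 0ℤ ≤ x * x
  square≥0 (+ n)    = lit {n} · lit {n}
  square≥0 -[1+ n ] = lit

  by : ∀ {x y} → x ≡ y → 0ℤ ≤ x → 0ℤ ≤ y
  by = subst (0ℤ ≤_)

  ≡neg⇒0≰ : ∀ {x n} → x ≡ -[1+ n ] → 0ℤ ≤ x → ⊥
  ≡neg⇒0≰ refl ()

  cancel-0≤ : ∀ x y → 0ℤ ≤ x - + 1 → 0ℤ ≤ x * y → 0ℤ ≤ y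
  cancel-0≤ +[1+ n ] y _ xy = *-cancelˡ-≤-pos 0ℤ y +[1+ n ] (subst (_≤ +[1+ n ] * y) (sym (*-zeroʳ +[1+ n ])) xy)

  squeeze : ∀ {x} → 0ℤ ≤ x → 0ℤ ≤ - x → x ≡ 0ℤ
  squeeze p q = ≤-antisym (neg-cancel-≤ q) p

  <⇒0≤-1 : ∀ {x y} → x < y → 0ℤ ≤ y - x - + 1
  <⇒0≤-1 {x} {y} x<y = by (id x y) (i≤j⇒0≤j-i (i<j⇒suc[i]≤j x<y))
    where
    id : ∀ x y → y - (+ 1 + x) ≡ y - x - + 1
    id = solve-∀

  vanishing : ∀ {a c g e} → 0ℤ ≤ a → 0ℤ ≤ c → 0ℤ ≤ g → 0ℤ ≤ e →
    0ℤ ≤ - ((e + + 1) * (a * a + + 2 * a + + 2 * c) + (a + + 4) * (a + + 2) * g) →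
    a ≡ 0ℤ × c ≡ 0ℤ × g ≡ 0ℤ
  vanishing {a} {c} {g} {e} 0≤a 0≤c 0≤g 0≤e 0≤-E =
    squeeze 0≤a (by (a-id a c g e) (0≤-E ⊹ (0≤a² ⊹ 0≤a ⊹ lit {2} · 0≤c ⊹ 0≤eM ⊹ 0≤kg))) ,
    squeeze 0≤c (by (c-id a c g e) (0≤-E ⊹ (0≤a² ⊹ lit {2} · 0≤a ⊹ 0≤c ⊹ 0≤eM ⊹ 0≤kg))) ,
    squeeze 0≤g (by (g-id a c g e) (0≤-E ⊹ (0≤M ⊹ 0≤eM ⊹ (0≤a² ⊹ lit {6} · 0≤a ⊹ lit {7}) · 0≤g)))
    where
    0≤a² = square≥0 a
    0≤M  = 0≤a² ⊹ lit {2} · 0≤a ⊹ lit {2} · 0≤c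
    0≤eM = 0≤e · 0≤M
    0≤kg = (0≤a ⊹ lit {4}) · (0≤a ⊹ lit {2}) · 0≤g
    a-id : ∀ a c g e → let M = a * a + + 2 * a + + 2 * c ; kg = (a + + 4) * (a + + 2) * g in
      - ((e + + 1) * M + kg) + (a * a + a + + 2 * c + e * M + kg) ≡ - a
    a-id = solve-∀
    c-id : ∀ a c g e → let M = a * a + + 2 * a + + 2 * c ; kg = (a + + 4) * (a + + 2) * g in
      - ((e + + 1) * M + kg) + (a * a + + 2 * a + c + e * M + kg) ≡ - c
    c-id = solve-∀
    g-id : ∀ a c g e → let M = a * a + + 2 * a + + 2 * c ; kg = (a + + 4) * (a + + 2) * g in
      - ((e + + 1) * M + kg) + (M + e * M + (a * a + + 6 * a + + 7) * g) ≡ - g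
    g-id = solve-∀

  full-parameters : ∀ a c g {k n R w} →
    k ≡ a + + 4 → R ≡ (a + + 3) * (a + + 2) + c + + 2 → n ≡ R + g → w ≡ k * (k - + 1) + + 1 →
    0ℤ ≤ a → 0ℤ ≤ c → 0ℤ ≤ g → 0ℤ ≤ k * k - k - R →
    0ℤ ≤ + 2 * (R * (R * (k - + 1) + + 1)) + k * (w * (w - + 1) - + 2 * w * R) - n * (k * (k - + 1) * (k - + 2)) →
    n ≡ R × R ≡ + 8 × k ≡ + 4
  full-parameters a c g refl refl refl refl 0≤a 0≤c 0≤g 0≤e 0≤★ =
    conclude (vanishing 0≤a 0≤c 0≤g 0≤e (cancel-0≤ (a + + 3) _ (by (shift a) (0≤a ⊹ lit {2})) (by (factor a c g) 0≤★)))
    where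
    shift : ∀ a → a + + 2 ≡ a + + 3 - + 1
    shift = solve-∀
    factor : ∀ a c g → let k = a + + 4 ; R = (a + + 3) * (a + + 2) + c + + 2 ; n = R + g ; w = k * (k - + 1) + + 1 in
      + 2 * (R * (R * (k - + 1) + + 1)) + k * (w * (w - + 1) - + 2 * w * R) - n * (k * (k - + 1) * (k - + 2))
      ≡ (a + + 3) * - ((k * k - k - R + + 1) * (a * a + + 2 * a + + 2 * c) + (a + + 4) * (a + + 2) * g)
    factor = solve-∀
    conclude : ∀ {a c g} → a ≡ 0ℤ × c ≡ 0ℤ × g ≡ 0ℤ →
      let R = (a + + 3) * (a + + 2) + c + + 2 in R + g ≡ R × R ≡ + 8 × a + + 4 ≡ + 4
    conclude (refl , refl , refl) = refl , refl , refl

  2≤root : ∀ K x → 0ℤ ≤ K - + 3 → 0ℤ ≤ x → 0ℤ ≤ + 16 * (x * x) - + 9 * (K + + 1) → 0ℤ ≤ x - + 2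
  2≤root K (+ 0) 3≤K _ h = ⊥-elim (≡neg⇒0≰ (id K) (h ⊹ lit {9} · 3≤K))
    where
    id : ∀ K → + 16 * (+ 0 * + 0) - + 9 * (K + + 1) + + 9 * (K - + 3) ≡ - + 36
    id = solve-∀
  2≤root K (+ 1) 3≤K _ h = ⊥-elim (≡neg⇒0≰ (id K) (h ⊹ lit {9} · 3≤K))
    where
    id : ∀ K → + 16 * (+ 1 * + 1) - + 9 * (K + + 1) + + 9 * (K - + 3) ≡ - + 20
    id = solve-∀
  2≤root K (+ ℕ.suc (ℕ.suc _)) _ _ _ = lit

  0≤-or-0< : ∀ x y → 0ℤ ≤ x - y ⊎ 0ℤ ≤ y - x - + 1
  0≤-or-0< x y with x <? y
  ... | yes x<y = inj₂ (<⇒0≤-1 x<y)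
  ... | no  x≮y = inj₁ (i≤j⇒0≤j-i (≮⇒≥ x≮y))

  module Cubic where
    cases : ∀ δ → 0ℤ ≤ δ - + 2 → δ ≡ + 2 ⊎ δ ≡ + 3 ⊎ 0ℤ ≤ δ - + 4
    cases (+ 2) _ = inj₁ refl
    cases (+ 3) _ = inj₂ (inj₁ refl)
    cases (+ ℕ.suc (ℕ.suc (ℕ.suc (ℕ.suc _)))) _ = inj₂ (inj₂ lit)

    small-id : ∀ K δ →
      + 16 * (K * (K + + 1) - δ * δ * (+ 2 * K + + 1 - δ))
      + (K - + 3 + (K - δ) + + 4) * (+ 16 * (δ * δ) - + 9 * (K + + 1))
      + (K - + 3 + + 4) * (+ 2 * (K - δ * δ) + (+ 2 * (δ - + 4) + + 7) * (δ - + 4)) + + 5 * (K - + 3) ≡ - + 20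
    small-id = solve-∀
    large-id : ∀ K δ → K * (K + + 1) - δ * δ * (+ 2 * K + + 1 - δ)
      + (K - + 3 + + 4) * (δ * δ - K - + 1) + δ * δ * (K - δ) + (K - + 3) ≡ - + 4
    large-id = solve-∀
    root-2 : ∀ K {δ} → δ ≡ + 2 → + 16 * (δ * δ) - + 9 * (K + + 1) ≡ + 55 - + 9 * K
    root-2 K refl = id K
      where
      id : ∀ K → + 16 * (+ 2 * + 2) - + 9 * (K + + 1) ≡ + 55 - + 9 * K
      id = solve-∀
    cubic-2 : ∀ K {δ} → δ ≡ + 2 → K * (K + + 1) - δ * δ * (+ 2 * K + + 1 - δ) ≡ K * K - + 7 * K + + 4
    cubic-2 K refl = id K
      where
      id : ∀ K → K * (K + + 1) - + 2 * + 2 * (+ 2 * K + + 1 - + 2) ≡ K * K - + 7 * K + + 4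
      id = solve-∀
    id-2 : ∀ K → + 81 * (K * K - + 7 * K + + 4) + + 9 * (K - + 3) * (+ 55 - + 9 * K) + + 19 * (+ 55 - + 9 * K) ≡ - + 116
    id-2 = solve-∀
    root-3 : ∀ K {δ} → δ ≡ + 3 → + 16 * (δ * δ) - + 9 * (K + + 1) ≡ + 135 - + 9 * K
    root-3 K refl = id K
      where
      id : ∀ K → + 16 * (+ 3 * + 3) - + 9 * (K + + 1) ≡ + 135 - + 9 * K
      id = solve-∀
    cubic-3 : ∀ K {δ} → δ ≡ + 3 → K * (K + + 1) - δ * δ * (+ 2 * K + + 1 - δ) ≡ K * K - + 17 * K + + 18
    cubic-3 K refl = id K
      where
      id : ∀ K → K * (K + + 1) - + 3 * + 3 * (+ 2 * K + + 1 - + 3) ≡ K * K - + 17 * K + + 18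
      id = solve-∀
    id-3 : ∀ K → + 9 * (K * K - + 17 * K + + 18) + (K - + 3 + + 1) * (+ 135 - + 9 * K) ≡ - + 108
    id-3 = solve-∀

    bound-2 : ∀ K → 0ℤ ≤ K - + 3 → 0ℤ ≤ + 55 - + 9 * K → 0ℤ ≤ K * K - + 7 * K + + 4 → ⊥
    bound-2 K 3≤K h F = ≡neg⇒0≰ (id-2 K) (lit {81} · F ⊹ lit {9} · 3≤K · h ⊹ lit {19} · h)

    bound-3 : ∀ K → 0ℤ ≤ K - + 3 → 0ℤ ≤ + 135 - + 9 * K → 0ℤ ≤ K * K - + 17 * K + + 18 → ⊥
    bound-3 K 3≤K h F = ≡neg⇒0≰ (id-3 K) (lit {9} · F ⊹ (3≤K ⊹ lit {1}) · h)

    bound-≥4 : ∀ K δ → 0ℤ ≤ K - + 3 → 0ℤ ≤ δ - + 4 → 0ℤ ≤ K - δ →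
      0ℤ ≤ + 16 * (δ * δ) - + 9 * (K + + 1) →
      0ℤ ≤ K * (K + + 1) - δ * δ * (+ 2 * K + + 1 - δ) → ⊥
    bound-≥4 K δ 3≤K 4≤δ δ≤K h F = [ small , large ]′ (0≤-or-0< K (δ * δ))
      where
      small : 0ℤ ≤ K - δ * δ → ⊥
      small δ²≤K = ≡neg⇒0≰ (small-id K δ)
        (lit {16} · F ⊹ (3≤K ⊹ δ≤K ⊹ lit {4}) · h
          ⊹ (3≤K ⊹ lit {4}) · (lit {2} · δ²≤K ⊹ (lit {2} · 4≤δ ⊹ lit {7}) · 4≤δ) ⊹ lit {5} · 3≤K)
      large : 0ℤ ≤ δ * δ - K - + 1 → ⊥
      large K<δ² = ≡neg⇒0≰ (large-id K δ)
        (F ⊹ (3≤K ⊹ lit {4}) · K<δ² ⊹ square≥0 δ · δ≤K ⊹ 3≤K)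

  cubic-bound : ∀ K δ → 0ℤ ≤ K - + 3 → 0ℤ ≤ δ - + 2 → 0ℤ ≤ K - δ →
    0ℤ ≤ + 16 * (δ * δ) - + 9 * (K + + 1) →
    0ℤ ≤ K * (K + + 1) - δ * δ * (+ 2 * K + + 1 - δ) → ⊥
  cubic-bound K δ 3≤K 2≤δ δ≤K h F =
    [ (λ δ≡2 → Cubic.bound-2 K 3≤K (by (Cubic.root-2 K δ≡2) h) (by (Cubic.cubic-2 K δ≡2) F)) ,
    [ (λ δ≡3 → Cubic.bound-3 K 3≤K (by (Cubic.root-3 K δ≡3) h) (by (Cubic.cubic-3 K δ≡3) F)) ,
      (λ 4≤δ → Cubic.bound-≥4 K δ 3≤K 4≤δ δ≤K h F) ]′ ]′ (Cubic.cases δ 2≤δ)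

  0≤consecutive : ∀ x → 0ℤ ≤ (x - + 1) * (x - + 2)
  0≤consecutive x = [ (λ x≤1 → by (below x) (x≤1 · (x≤1 ⊹ lit {1}))) , (λ 1<x → by (above x) ((1<x ⊹ lit {1}) · 1<x)) ]′ (0≤-or-0< (+ 1) x)
    where
    below : ∀ x → (+ 1 - x) * (+ 1 - x + + 1) ≡ (x - + 1) * (x - + 2)
    below = solve-∀
    above : ∀ x → (x - + 1 - + 1 + + 1) * (x - + 1 - + 1) ≡ (x - + 1) * (x - + 2)
    above = solve-∀

  module Sparse-identities where
    δ-root-id : ∀ K ρ g → + 16 * (ρ * ρ) - + 9 * (K + + 1) + + 16 * (g * (+ 2 * ρ + g))
      ≡ + 16 * ((ρ + g) * (ρ + g)) - + 9 * (K + + 1)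
    δ-root-id = solve-∀
    2≤δ-id : ∀ ρ g → ρ - + 2 + g ≡ ρ + g - + 2
    2≤δ-id = solve-∀
    +3-id : ∀ x → x - + 3 + + 3 ≡ x
    +3-id = solve-∀
    +1-id : ∀ x → x - + 1 + + 1 ≡ x
    +1-id = solve-∀
    K-1-id : ∀ K → K - + 3 + + 2 ≡ K - + 1
    K-1-id = solve-∀
    K-2-id : ∀ K → K - + 3 + + 1 ≡ K - + 1 - + 1
    K-2-id = solve-∀
    n-id : ∀ K δ → K * (K - + 3 + + 2) + δ ≡ K * (K - + 1) + δ
    n-id = solve-∀
    n-1-id : ∀ K δ → (K - + 3 + + 2) * (K - + 3 + + 2) + (K - + 3) + (δ - + 2) + + 3 ≡ K * (K - + 1) + δ - + 1
    n-1-id = solve-∀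
    Ku-id : ∀ K δ u → let n = K * (K - + 1) + δ in
      K * (n + u) - n * (K + + 1) + δ ≡ K * (u - (K - + 1))
    Ku-id = solve-∀
    u-1-id : ∀ K u → u - (K - + 1) + (K - + 3) + + 1 ≡ u - + 1
    u-1-id = solve-∀
    drop-0 : ∀ g → g - 0ℤ - + 1 ≡ g - + 1
    drop-0 = solve-∀
    neg-id : ∀ g → 0ℤ - g ≡ - g
    neg-id = solve-∀
    Y-id : ∀ K ρ g u → let δ = ρ + g ; n = K * (K - + 1) + δ ; R = K * (K - + 1) + ρ in
      + 3 * K * (ρ - + 2) + K * (+ 2 * (K - + 3) + + 3) * (K - + 3 + + 1) + + 3
        + (K - δ) * (K + + 4) + (K + + 1) * (n - u * δ + u * (ρ - + 2 + (g - + 1)))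
      ≡ + 3 * (R * K + + 1 - n - u - u * K)
    Y-id = solve-∀
    Z-id : ∀ K ρ g u → let k = K + + 1 ; δ = ρ + g ; n = K * (K - + 1) + δ ; R = K * (K - + 1) + ρ ; w = n + u in
      + 2 * (R * (R * (k - + 1) + + 1)) + k * (w * (w - + 1) - + 2 * w * R) - n * (k * (k - + 1) * (k - + 2))
        + + 2 * (g * (R * K + + 1 - n - u - u * K))
      ≡ (K + + 1) * (u * (u - + 1)) - (K - + 1) * (n * (+ 2 * K + + 1 - δ))
    Z-id = solve-∀
    final-id : ∀ K δ u → let n = K * (K - + 1) + δ in
      δ * δ * ((K + + 1) * (u * (u - + 1)) - (K - + 1) * (n * (+ 2 * K + + 1 - δ)))
        + (K - + 3 + + 4) * ((n - u * δ) * (n + (u - + 1) * δ))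
      ≡ (K - + 1) * (n * (K * (K + + 1) - δ * δ * (+ 2 * K + + 1 - δ)))
    final-id = solve-∀

    -- The star inequality for r = |S| - g differs from the one for r = |S| by 2 Y,
    -- where Y = g (r K + 1 - |S| - u - u K); so Y ≥ 0 reduces it to the case g = 0.
    0≤Y : ∀ K ρ g u → let δ = ρ + g ; n = K * (K - + 1) + δ ; R = K * (K - + 1) + ρ in
      0ℤ ≤ K - + 3 → 0ℤ ≤ K → 0ℤ ≤ ρ - + 2 → 0ℤ ≤ g → 0ℤ ≤ u → 0ℤ ≤ K - δ → 0ℤ ≤ n - u * δ →
      0ℤ ≤ g * (R * K + + 1 - n - u - u * K)
    0≤Y K ρ g u 3≤K 0≤K 2≤ρ 0≤g 0≤u δ≤K uδ≤n = [ zero-case , positive-case ]′ (0≤-or-0< 0ℤ g)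
      where
      zero-case : 0ℤ ≤ 0ℤ - g → _
      zero-case g≤0 = subst
        (λ h → 0ℤ ≤ h * ((K * (K - + 1) + ρ) * K + + 1 - (K * (K - + 1) + (ρ + g)) - u - u * K))
        (sym (squeeze 0≤g (by (neg-id g) g≤0))) lit
      positive-case : 0ℤ ≤ g - 0ℤ - + 1 → _
      positive-case 0<g = 0≤g · cancel-0≤ (+ 3) _ lit (by (Y-id K ρ g u)
        (lit {3} · 0≤K · 2≤ρ ⊹ 0≤K · (lit {2} · 3≤K ⊹ lit {3}) · (3≤K ⊹ lit {1}) ⊹ lit {3}
          ⊹ δ≤K · (0≤K ⊹ lit {4}) ⊹ (0≤K ⊹ lit {1}) · (uδ≤n ⊹ 0≤u · (2≤ρ ⊹ by (drop-0 g) 0<g))))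

    contradiction-Z : ∀ K δ u → let n = K * (K - + 1) + δ in
      0ℤ ≤ K - + 3 → 0ℤ ≤ K → 0ℤ ≤ δ - + 2 → 0ℤ ≤ δ → 0ℤ ≤ K - δ → 0ℤ ≤ u - + 1 →
      0ℤ ≤ + 16 * (δ * δ) - + 9 * (K + + 1) → 0ℤ ≤ n - u * δ →
      0ℤ ≤ (K + + 1) * (u * (u - + 1)) - (K - + 1) * (n * (+ 2 * K + + 1 - δ)) → ⊥
    contradiction-Z K δ u 3≤K 0≤K 2≤δ 0≤δ δ≤K 1≤u δ-root uδ≤n 0≤Z = cubic-bound K δ 3≤K 2≤δ δ≤K δ-root
      (cancel-0≤ (K * (K - + 1) + δ) (K * (K + + 1) - δ * δ * (+ 2 * K + + 1 - δ))
        (by (n-1-id K δ) ((3≤K ⊹ lit {2}) · (3≤K ⊹ lit {2}) ⊹ 3≤K ⊹ 2≤δ ⊹ lit {3}))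
        (cancel-0≤ (K - + 1) ((K * (K - + 1) + δ) * (K * (K + + 1) - δ * δ * (+ 2 * K + + 1 - δ)))
          (by (K-2-id K) (3≤K ⊹ lit {1}))
          (by (final-id K δ u)
            (square≥0 δ · 0≤Z ⊹ (3≤K ⊹ lit {4}) · (uδ≤n · (by (n-id K δ) (0≤K · (3≤K ⊹ lit {2}) ⊹ 0≤δ) ⊹ 1≤u · 0≤δ))))))

  sparse-parameters-shifted : ∀ K ρ g u → let k = K + + 1 ; δ = ρ + g ; n = K * (K - + 1) + δ ; R = K * (K - + 1) + ρ ; w = n + u in
    0ℤ ≤ K - + 3 → 0ℤ ≤ ρ → 0ℤ ≤ g → 0ℤ ≤ + 16 * (ρ * ρ) - + 9 * k → 0ℤ ≤ K - δ →
    0ℤ ≤ n - u * δ → 0ℤ ≤ K * w - n * k →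
    0ℤ ≤ + 2 * (R * (R * (k - + 1) + + 1)) + k * (w * (w - + 1) - + 2 * w * R) - n * (k * (k - + 1) * (k - + 2)) → ⊥
  sparse-parameters-shifted K ρ g u 3≤K 0≤ρ 0≤g ρ-root δ≤K uδ≤n n≤Ku 0≤★ =
    contradiction-Z K (ρ + g) u 3≤K 0≤K (by (2≤δ-id ρ g) (2≤ρ ⊹ 0≤g)) (0≤ρ ⊹ 0≤g) δ≤K 1≤u
      (by (δ-root-id K ρ g) (ρ-root ⊹ lit {16} · (0≤g · (lit {2} · 0≤ρ ⊹ 0≤g)))) uδ≤n
      (by (Z-id K ρ g u) (0≤★ ⊹ lit {2} · 0≤Y K ρ g u 3≤K 0≤K 2≤ρ 0≤g (by (+1-id u) (1≤u ⊹ lit {1})) δ≤K uδ≤n))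
    where
    open Sparse-identities
    2≤ρ : 0ℤ ≤ ρ - + 2
    2≤ρ = 2≤root K ρ 3≤K 0≤ρ ρ-root
    0≤K : 0ℤ ≤ K
    0≤K = by (+3-id K) (3≤K ⊹ lit {3})
    1≤u : 0ℤ ≤ u - + 1
    1≤u = by (u-1-id K u) (cancel-0≤ K (u - (K - + 1)) (by (K-1-id K) (3≤K ⊹ lit {2}))
      (by (Ku-id K (ρ + g) u) (n≤Ku ⊹ (0≤ρ ⊹ 0≤g))) ⊹ 3≤K ⊹ lit {1})

  module Parameters where
    K-3 : ∀ k → k - + 4 ≡ k - + 1 - + 3
    K-3 = solve-∀
    k≡ : ∀ k → k ≡ k - + 1 + + 1
    k≡ = solve-∀
    R≡ : ∀ k R → R ≡ (k - + 1) * (k - + 1 - + 1) + (R - (k - + 1) * (k - + 2))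
    R≡ = solve-∀
    n≡ : ∀ k R n → n ≡ (k - + 1) * (k - + 1 - + 1) + ((R - (k - + 1) * (k - + 2)) + (n - R))
    n≡ = solve-∀
    w≡ : ∀ n w → w ≡ n + (w - n)
    w≡ = solve-∀
    δ≡ : ∀ k n R → n - (k - + 1) * (k - + 1 - + 1) ≡ (R - (k - + 1) * (k - + 2)) + (n - R)
    δ≡ = solve-∀

    unshift : ∀ K ρ g u {k n R w δ} →
      k ≡ K + + 1 → R ≡ K * (K - + 1) + ρ → n ≡ K * (K - + 1) + (ρ + g) → w ≡ n + u → δ ≡ ρ + g →
      0ℤ ≤ K - + 3 → 0ℤ ≤ ρ → 0ℤ ≤ g → 0ℤ ≤ + 16 * (ρ * ρ) - + 9 * k → 0ℤ ≤ K - δ →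
      0ℤ ≤ n - u * δ → 0ℤ ≤ K * w - n * k →
      0ℤ ≤ + 2 * (R * (R * (k - + 1) + + 1)) + k * (w * (w - + 1) - + 2 * w * R) - n * (k * (k - + 1) * (k - + 2)) → ⊥
    unshift K ρ g u refl refl refl refl refl = sparse-parameters-shifted K ρ g u

  sparse-parameters : ∀ k n R w → let K = k - + 1 ; ρ = R - (k - + 1) * (k - + 2) ; δ = n - K * (K - + 1) in
    0ℤ ≤ k - + 4 → 0ℤ ≤ ρ → 0ℤ ≤ + 16 * (ρ * ρ) - + 9 * k → 0ℤ ≤ n - R →
    0ℤ ≤ K - δ → 0ℤ ≤ n - (w - n) * δ → 0ℤ ≤ K * w - n * k →
    0ℤ ≤ + 2 * (R * (R * (k - + 1) + + 1)) + k * (w * (w - + 1) - + 2 * w * R) - n * (k * (k - + 1) * (k - + 2)) → ⊥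
  sparse-parameters k n R w 4≤k 0≤ρ ρ-root R≤n =
    unshift (k - + 1) (R - (k - + 1) * (k - + 2)) (n - R) (w - n)
      (k≡ k) (R≡ k R) (n≡ k R n) (w≡ n w) (δ≡ k n R) (by (K-3 k) 4≤k) 0≤ρ R≤n ρ-root
    where open Parameters

module Sums where
  open Arithmetic using (lit)
  open import Data.Bool.Base using (if_then_else_)
  open import Data.Empty using (⊥-elim)
  open import Data.Fin.Base using (Fin; zero; suc)
  open import Data.Fin.Properties using (_≟_)
  open import Data.Fin.Subset using (Subset; ∣_∣; inside; outside)
  open import Data.Fin.Subset.Properties using (_∈?_)
  open import Data.Integer.Base hiding (suc; pred; ∣_∣)
  open import Data.Integer.Properties hiding (_≟_)
  open import Data.Integer.Tactic.RingSolver using (solve-∀)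
  open import Data.Nat.Base as ℕ using (ℕ)
  open import Data.Product using (_×_; _,_)
  open import Data.Vec.Base using ([]; _∷_)
  open import Function.Base using (_∘_)
  open import Relation.Binary.PropositionalEquality
  open import Relation.Nullary using (Dec; yes; no; ¬_; does)
  open import Algebra.Properties.Semiring.Sum +-*-semiring
    using (sum; sum-cong-≗; ∑-distrib-+; ∑-comm; *-distribˡ-sum; sum-replicate-zero)
  open ≡-Reasoning

  private variable
    m n : ℕ

  abstract
    ∑ : (Fin n → ℤ) → ℤ
    ∑ = sum

    ∑-cong : {f g : Fin n → ℤ} → (∀ i → f i ≡ g i) → ∑ f ≡ ∑ g
    ∑-cong = sum-cong-≗

    ∑-zero : {f : Fin n → ℤ} → (∀ i → f i ≡ 0ℤ) → ∑ f ≡ 0ℤ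
    ∑-zero {n} f≡0 = trans (sum-cong-≗ f≡0) (sum-replicate-zero n)

    ∑-+ : (f g : Fin n → ℤ) → ∑ (λ i → f i + g i) ≡ ∑ f + ∑ g
    ∑-+ = ∑-distrib-+

    ∑-swap : (f : Fin m → Fin n → ℤ) → ∑ (λ i → ∑ (f i)) ≡ ∑ (λ j → ∑ (λ i → f i j))
    ∑-swap = ∑-comm

    *-∑ : (x : ℤ) (f : Fin n → ℤ) → ∑ (λ i → x * f i) ≡ x * ∑ f
    *-∑ x f = sym (*-distribˡ-sum x f)

    ∑-mono-≤ : {f g : Fin n → ℤ} → (∀ i → f i ≤ g i) → ∑ f ≤ ∑ g
    ∑-mono-≤ {ℕ.zero}  f≤g = ≤-refl
    ∑-mono-≤ {ℕ.suc n} f≤g = +-mono-≤ (f≤g zero) (∑-mono-≤ (f≤g ∘ suc))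

    ∑-one : ∀ n → ∑ {n} (λ _ → + 1) ≡ + n
    ∑-one ℕ.zero    = refl
    ∑-one (ℕ.suc n) = cong (_+_ (+ 1)) (∑-one n)

    ∑-select : (f : Fin n → ℤ) (j : Fin n) → (∀ i → i ≢ j → f i ≡ 0ℤ) → ∑ f ≡ f j
    ∑-select {ℕ.suc n} f zero off =
      trans (cong (_+_ (f zero)) (∑-zero (λ i → off (suc i) λ ()))) (+-identityʳ _)
    ∑-select {ℕ.suc n} f (suc j) off =
      trans (cong₂ _+_ (off zero λ ()) (∑-select (f ∘ suc) j (λ i i≢j → off (suc i) λ { refl → i≢j refl })))
        (+-identityˡ _)

  ∑-0≤ : {f : Fin n → ℤ} → (∀ i → 0ℤ ≤ f i) → 0ℤ ≤ ∑ f
  ∑-0≤ {f = f} 0≤f = subst (_≤ ∑ f) (∑-zero {f = λ _ → 0ℤ} (λ _ → refl)) (∑-mono-≤ 0≤f)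

  abstract
    ∑-term-≤ : {f : Fin n → ℤ} → (∀ i → 0ℤ ≤ f i) → ∀ j → f j ≤ ∑ f
    ∑-term-≤ {ℕ.suc n} {f} 0≤f zero = subst (_≤ ∑ f) (+-identityʳ (f zero)) (+-monoʳ-≤ (f zero) (∑-0≤ (0≤f ∘ suc)))
    ∑-term-≤ {ℕ.suc n} {f} 0≤f (suc j) = ≤-trans (∑-term-≤ (0≤f ∘ suc) j)
      (subst (_≤ ∑ f) (+-identityˡ (∑ (f ∘ suc))) (+-monoˡ-≤ (∑ (f ∘ suc)) (0≤f zero)))

  ∑-exchange : (f : Fin m → ℤ) (a : Fin m → Fin n → ℤ) (g : Fin n → ℤ) →
    ∑ (λ i → f i * ∑ (λ j → g j * a i j)) ≡ ∑ (λ j → g j * ∑ (λ i → f i * a i j))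
  ∑-exchange f a g = begin
    ∑ (λ i → f i * ∑ (λ j → g j * a i j))      ≡⟨ ∑-cong (λ i → *-∑ (f i) _) ⟨
    ∑ (λ i → ∑ (λ j → f i * (g j * a i j)))    ≡⟨ ∑-swap _ ⟩
    ∑ (λ j → ∑ (λ i → f i * (g j * a i j)))    ≡⟨ ∑-cong (λ j → ∑-cong (λ i → swap (f i) (g j) (a i j))) ⟩
    ∑ (λ j → ∑ (λ i → g j * (f i * a i j)))    ≡⟨ ∑-cong (λ j → *-∑ (g j) _) ⟩
    ∑ (λ j → g j * ∑ (λ i → f i * a i j))      ∎
    where
    swap : ∀ x y z → x * (y * z) ≡ y * (x * z)
    swap = solve-∀

  𝟙 : ∀ {a} {P : Set a} → Dec P → ℤ
  𝟙 P? = if does P? then + 1 else 0ℤ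

  𝟙-yes : ∀ {a} {P : Set a} (P? : Dec P) → P → 𝟙 P? ≡ + 1
  𝟙-yes (yes _) _ = refl
  𝟙-yes (no ¬p) p = ⊥-elim (¬p p)

  𝟙-no : ∀ {a} {P : Set a} (P? : Dec P) → ¬ P → 𝟙 P? ≡ 0ℤ
  𝟙-no (yes p) ¬p = ⊥-elim (¬p p)
  𝟙-no (no _)  _  = refl

  𝟙-idem : ∀ {a} {P : Set a} (P? : Dec P) → 𝟙 P? * 𝟙 P? ≡ 𝟙 P?
  𝟙-idem (yes _) = refl
  𝟙-idem (no _)  = refl

  𝟙-*-≡0 : ∀ {a b} {P : Set a} {Q : Set b} (P? : Dec P) (Q? : Dec Q) → ¬ (P × Q) → 𝟙 P? * 𝟙 Q? ≡ 0ℤ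
  𝟙-*-≡0 (yes p) (yes q) ¬pq = ⊥-elim (¬pq (p , q))
  𝟙-*-≡0 (yes _) (no _)  _   = refl
  𝟙-*-≡0 (no _)  (yes _) _   = refl
  𝟙-*-≡0 (no _)  (no _)  _   = refl

  0≤𝟙 : ∀ {a} {P : Set a} (P? : Dec P) → 0ℤ ≤ 𝟙 P?
  0≤𝟙 (yes _) = lit
  0≤𝟙 (no _)  = lit

  0≤1-𝟙 : ∀ {a} {P : Set a} (P? : Dec P) → 0ℤ ≤ + 1 - 𝟙 P?
  0≤1-𝟙 (yes _) = lit
  0≤1-𝟙 (no _)  = lit

  abstract
    ∑-𝟙-∈ : (s : Subset n) → ∑ (λ i → 𝟙 (i ∈? s)) ≡ + ∣ s ∣
    ∑-𝟙-∈ []            = refl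
    ∑-𝟙-∈ (inside ∷ s)  = cong (_+_ (+ 1)) (∑-𝟙-∈ s)
    ∑-𝟙-∈ (outside ∷ s) = trans (+-identityˡ _) (∑-𝟙-∈ s)

  ∑-affine : (f : Fin n → ℤ) (x : ℤ) (j : Fin n) →
    ∑ (λ i → f i * (+ 1 + x * 𝟙 (i ≟ j))) ≡ ∑ f + x * f j
  ∑-affine f x j = begin
    ∑ (λ i → f i * (+ 1 + x * 𝟙 (i ≟ j)))        ≡⟨ ∑-cong (λ i → expand (f i) x (𝟙 (i ≟ j))) ⟩
    ∑ (λ i → f i + x * (f i * 𝟙 (i ≟ j)))        ≡⟨ ∑-+ f _ ⟩
    ∑ f + ∑ (λ i → x * (f i * 𝟙 (i ≟ j)))        ≡⟨ cong (_+_ (∑ f)) (*-∑ x _) ⟩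
    ∑ f + x * ∑ (λ i → f i * 𝟙 (i ≟ j))          ≡⟨ cong (λ y → ∑ f + x * y) select ⟩
    ∑ f + x * f j                                ∎
    where
    expand : ∀ a x d → a * (+ 1 + x * d) ≡ a + x * (a * d)
    expand = solve-∀
    select : ∑ (λ i → f i * 𝟙 (i ≟ j)) ≡ f j
    select = begin
      ∑ (λ i → f i * 𝟙 (i ≟ j))    ≡⟨ ∑-select _ j (λ i i≢j → trans (cong (f i *_) (𝟙-no (i ≟ j) i≢j)) (*-zeroʳ (f i))) ⟩
      f j * 𝟙 (j ≟ j)              ≡⟨ cong (f j *_) (𝟙-yes (j ≟ j) refl) ⟩
      f j * + 1                    ≡⟨ *-identityʳ _ ⟩
      f j                          ∎

module Designs where
  open Arithmetic
  open Sums
  open import Defs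
  open import Data.Empty using (⊥; ⊥-elim)
  open import Data.Fin.Base using (Fin; fromℕ<)
  open import Data.Fin.Properties using (_≟_; any?; all?; ¬∀⟶∃¬)
  open import Data.Fin.Subset using (Subset; _∈_; _⊆_; ∣_∣; inside)
  open import Data.Fin.Subset.Properties using (_∈?_; x∈p∩q⁻; p⊆q⇒∣p∣≤∣q∣; p⊂q⇒∣p∣<∣q∣)
  open import Data.Integer.Base hiding (suc; pred; ∣_∣)
  open import Data.Integer.Properties as ℤ hiding (_≟_)
  open import Data.Integer.Tactic.RingSolver using (solve-∀)
  open import Data.Nat.Base as ℕ using (ℕ)
  import Data.Nat.Properties as ℕ
  open import Data.Product using (_×_; _,_; ∃; proj₁; proj₂)
  open import Data.Sum.Base using (_⊎_; inj₁; inj₂)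
  open import Data.Vec.Base using (tabulate)
  open import Data.Vec.Properties using (lookup⇒[]=; []=⇒lookup; lookup∘tabulate)
  open import Function.Base using (_∘_)
  open import Function.Bundles using (mk⇔; Equivalence)
  open import Relation.Binary.PropositionalEquality
  open import Relation.Nullary using (Dec; yes; no; ¬_; does)
  open import Relation.Nullary.Decidable using (_×-dec_; ¬?; dec-true)
  open ≡-Reasoning

  module Counting-identities where
    collect : ∀ k b n R w → k * ((w * w + (R - + 1) * w) + (- + 3) * (R * w) + (+ 2 * b + (- ((k - + 1) * (k - + 2))) * n))
      ≡ + 2 * (k * b) + k * (w * (w - + 1) - + 2 * w * R) - n * (k * (k - + 1) * (k - + 2))
    collect = solve-∀
    total-deficiency-id : ∀ k n → let K = k - + 1 in
      K * (k * n) + (- + 1) * (n * (n + K * + 1)) ≡ n * (K - (n - K * (K - + 1)))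
    total-deficiency-id = solve-∀
    block-deficiency-id : ∀ k n → let K = k - + 1 in
      K * k + (- + 1) * (n + K * + 1) ≡ K - (n - K * (K - + 1))
    block-deficiency-id = solve-∀
    lower-id : ∀ k n w → (k - + 1) * w + (- + 1) * (k * n) ≡ (k - + 1) * w - n * k
    lower-id = solve-∀
    upper-id : ∀ k n w → let K = k - + 1 ; δ = n - K * (K - + 1) in
      K * (k * n + (- δ) * w) + (- + 1) * (n * (n + K * + 1) + (- δ) * (k * n)) ≡ K * (n - (w - n) * δ)
    upper-id = solve-∀
    K-1-id : ∀ k → k - + 4 + + 2 ≡ k - + 1 - + 1
    K-1-id = solve-∀
    k≡ : ∀ k → k ≡ k - + 4 + + 4
    k≡ = solve-∀
    R≡ : ∀ k R → R ≡ (k - + 4 + + 3) * (k - + 4 + + 2) + (R - (k - + 1) * (k - + 2) - + 2) + + 2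
    R≡ = solve-∀
    n≡ : ∀ R n → n ≡ R + (n - R)
    n≡ = solve-∀
    K-3 : ∀ k → k - + 4 ≡ k - + 1 - + 3
    K-3 = solve-∀
    +1-id : ∀ k → k ≡ k - + 1 + + 1
    +1-id = solve-∀
  open Counting-identities

  module Counting {v k : ℕ} (𝓓 : Design v k) where
    open Design 𝓓

    χ : Fin b → Fin v → ℤ
    χ B p = 𝟙 (p ∈? block B)

    degree : Fin v → ℤ
    degree p = ∑ (λ B → χ B p)

    ∑-χ : ∀ B → ∑ (χ B) ≡ + k
    ∑-χ B = trans (∑-𝟙-∈ (block B)) (cong +_ (block-size B))

    module _ {p q : Fin v} (p≢q : p ≢ q) where
      line : Fin b
      line = proj₁ (joining-block p≢q)

      p∈line : p ∈ block line
      p∈line = proj₁ (proj₁ (proj₂ (joining-block p≢q)))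

      q∈line : q ∈ block line
      q∈line = proj₂ (proj₁ (proj₂ (joining-block p≢q)))

      line-unique : ∀ {B} → p ∈ block B → q ∈ block B → line ≡ B
      line-unique p∈B q∈B = proj₂ (proj₂ (joining-block p≢q)) (p∈B , q∈B)

      ∑-line : (f : Fin b → ℤ) → ∑ (λ B → f B * (χ B p * χ B q)) ≡ f line
      ∑-line f = begin
        ∑ (λ B → f B * (χ B p * χ B q))    ≡⟨ ∑-select _ line off-line ⟩
        f line * (χ line p * χ line q)     ≡⟨ cong₂ (λ x y → f line * (x * y)) (𝟙-yes (p ∈? block line) p∈line) (𝟙-yes (q ∈? block line) q∈line) ⟩
        f line * + 1                       ≡⟨ *-identityʳ _ ⟩
        f line                             ∎
        where
        off-line : ∀ B → B ≢ line → f B * (χ B p * χ B q) ≡ 0ℤ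
        off-line B B≢line = trans (cong (f B *_) 
          (𝟙-*-≡0 (p ∈? block B) (q ∈? block B) (λ (p∈B , q∈B) → B≢line (sym (line-unique p∈B q∈B))))) (*-zeroʳ (f B))

    codegree : ∀ p q → ∑ (λ B → χ B p * χ B q) ≡ + 1 * (+ 1 + (degree p - + 1) * 𝟙 (q ≟ p))
    codegree p q with q ≟ p
    ... | yes refl = trans (∑-cong (λ B → 𝟙-idem (q ∈? block B))) (diagonal (degree q))
      where
      diagonal : ∀ d → d ≡ + 1 * (+ 1 + (d - + 1) * + 1)
      diagonal = solve-∀
    ... | no q≢p = begin
      ∑ (λ B → χ B p * χ B q)             ≡⟨ ∑-cong (λ B → *-identityˡ _) ⟨
      ∑ (λ B → + 1 * (χ B p * χ B q))     ≡⟨ ∑-line (q≢p ∘ sym) (λ _ → + 1) ⟩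
      + 1                                 ≡⟨ off-diagonal (degree p) ⟩
      + 1 * (+ 1 + (degree p - + 1) * 0ℤ) ∎
      where
      off-diagonal : ∀ d → + 1 ≡ + 1 * (+ 1 + (d - + 1) * 0ℤ)
      off-diagonal = solve-∀

    ∑-codegree : (f : Fin v → ℤ) (p : Fin v) →
      ∑ (λ q → f q * ∑ (λ B → χ B p * χ B q)) ≡ ∑ f + (degree p - + 1) * f p
    ∑-codegree f p = trans
      (∑-cong (λ q → cong (f q *_) (trans (codegree p q) (*-identityˡ _))))
      (∑-affine f (degree p - + 1) p)

    degree-equation : ∀ p → degree p * (+ k - + 1) ≡ + v - + 1
    degree-equation p = rearrange (degree p) (+ k) (+ v) (begin
      degree p * + k                                   ≡⟨ *-comm (degree p) (+ k) ⟩
      + k * degree p                                   ≡⟨ *-∑ (+ k) _ ⟨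
      ∑ (λ B → + k * χ B p)                            ≡⟨ ∑-cong (λ B → *-comm (+ k) (χ B p)) ⟩
      ∑ (λ B → χ B p * + k)                            ≡⟨ ∑-cong (λ B → cong (χ B p *_) (∑-χ B)) ⟨
      ∑ (λ B → χ B p * ∑ (χ B))                        ≡⟨ ∑-cong (λ B → cong (χ B p *_) (∑-cong (λ q → *-identityˡ (χ B q)))) ⟨
      ∑ (λ B → χ B p * ∑ (λ q → + 1 * χ B q))          ≡⟨ ∑-exchange (λ B → χ B p) χ (λ _ → + 1) ⟩
      ∑ (λ q → + 1 * ∑ (λ B → χ B p * χ B q))          ≡⟨ ∑-codegree (λ _ → + 1) p ⟩
      ∑ {v} (λ _ → + 1) + (degree p - + 1) * + 1       ≡⟨ cong (_+ (degree p - + 1) * + 1) (∑-one v) ⟩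
      + v + (degree p - + 1) * + 1                     ∎)
      where
      step₁ : ∀ d k → d * (k - + 1) ≡ d * k - d
      step₁ = solve-∀
      step₂ : ∀ d v → v + (d - + 1) * + 1 - d ≡ v - + 1
      step₂ = solve-∀
      rearrange : ∀ d k v → d * k ≡ v + (d - + 1) * + 1 → d * (k - + 1) ≡ v - + 1
      rearrange d k v eq = trans (step₁ d k) (trans (cong (_- d) eq) (step₂ d v))

  module Regular {v k : ℕ} (𝓓 : Design v k) (R : ℤ)
    (degree≡R : ∀ p → Counting.degree 𝓓 p ≡ R) (point : Fin v) where
    open Design 𝓓
    open Counting 𝓓

    module Star (τ : Fin v → ℤ) (τ-idem : ∀ p → τ p * τ p ≡ τ p) where

      w : ℤ
      w = ∑ τ

      t : Fin b → ℤ
      t C = ∑ (λ p → τ p * χ C p)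

      ∑-t : ∑ t ≡ R * w
      ∑-t = begin
        ∑ t                                                  ≡⟨ ∑-cong (λ C → *-identityˡ (t C)) ⟨
        ∑ (λ C → + 1 * ∑ (λ p → τ p * χ C p))                ≡⟨ ∑-exchange (λ _ → + 1) χ τ ⟩
        ∑ (λ p → τ p * ∑ (λ C → + 1 * χ C p))                ≡⟨ ∑-cong (λ p → cong (τ p *_) (trans (∑-cong (λ C → *-identityˡ _)) (degree≡R p))) ⟩
        ∑ (λ p → τ p * R)                                    ≡⟨ ∑-cong (λ p → *-comm (τ p) R) ⟩
        ∑ (λ p → R * τ p)                                    ≡⟨ *-∑ R τ ⟩
        R * w                                                ∎

      ∑-χt : ∀ p → ∑ (λ C → χ C p * t C) ≡ w + (R - + 1) * τ p
      ∑-χt p = begin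
        ∑ (λ C → χ C p * t C)                        ≡⟨ ∑-exchange (λ C → χ C p) χ τ ⟩
        ∑ (λ q → τ q * ∑ (λ C → χ C p * χ C q))      ≡⟨ ∑-codegree τ p ⟩
        w + (degree p - + 1) * τ p                   ≡⟨ cong (λ d → w + (d - + 1) * τ p) (degree≡R p) ⟩
        w + (R - + 1) * τ p                          ∎

      ∑-t² : ∑ (λ C → t C * t C) ≡ w * w + (R - + 1) * w
      ∑-t² = begin
        ∑ (λ C → t C * ∑ (λ p → τ p * χ C p))          ≡⟨ ∑-exchange t χ τ ⟩
        ∑ (λ p → τ p * ∑ (λ C → t C * χ C p))          ≡⟨ ∑-cong (λ p → cong (τ p *_) (∑-cong (λ C → *-comm (t C) (χ C p)))) ⟩
        ∑ (λ p → τ p * ∑ (λ C → χ C p * t C))          ≡⟨ ∑-cong (λ p → cong (τ p *_) (∑-χt p)) ⟩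
        ∑ (λ p → τ p * (w + (R - + 1) * τ p))          ≡⟨ ∑-cong (λ p → trans (expand (τ p) w R) (cong (λ x → w * τ p + (R - + 1) * x) (τ-idem p))) ⟩
        ∑ (λ p → w * τ p + (R - + 1) * τ p)            ≡⟨ ∑-+ _ _ ⟩
        ∑ (λ p → w * τ p) + ∑ (λ p → (R - + 1) * τ p)  ≡⟨ cong₂ _+_ (*-∑ w τ) (*-∑ (R - + 1) τ) ⟩
        w * w + (R - + 1) * w                          ∎
        where
        expand : ∀ a w R → a * (w + (R - + 1) * a) ≡ w * a + (R - + 1) * (a * a)
        expand = solve-∀

    k*b : + k * + b ≡ + v * R
    k*b = begin
      + k * + b                                     ≡⟨ cong (+ k *_) (∑-one b) ⟨
      + k * ∑ {b} (λ _ → + 1)                       ≡⟨ *-∑ (+ k) (λ _ → + 1) ⟨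
      ∑ {b} (λ _ → + k * + 1)                       ≡⟨ ∑-cong (λ B → trans (*-comm (+ k) (+ 1)) (cong (+ 1 *_) (sym (∑-χ′ B)))) ⟩
      ∑ (λ B → + 1 * ∑ (λ p → + 1 * χ B p))         ≡⟨ ∑-exchange (λ _ → + 1) χ (λ _ → + 1) ⟩
      ∑ (λ p → + 1 * ∑ (λ B → + 1 * χ B p))         ≡⟨ ∑-cong (λ p → trans (*-comm (+ 1) _) (cong (_* + 1) (degree′ p))) ⟩
      ∑ {v} (λ _ → R * + 1)                         ≡⟨ *-∑ R (λ _ → + 1) ⟩
      R * ∑ {v} (λ _ → + 1)                         ≡⟨ cong (R *_) (∑-one v) ⟩
      R * + v                                       ≡⟨ *-comm R (+ v) ⟩
      + v * R                                       ∎
      where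
      ∑-χ′ : ∀ B → ∑ (λ p → + 1 * χ B p) ≡ + k
      ∑-χ′ B = trans (∑-cong (λ p → *-identityˡ (χ B p))) (∑-χ B)
      degree′ : ∀ p → ∑ (λ B → + 1 * χ B p) ≡ R
      degree′ p = trans (∑-cong (λ B → *-identityˡ (χ B p))) (degree≡R p)

    v-equation : + v ≡ R * (+ k - + 1) + + 1
    v-equation = rearrange R (+ k) (+ v) (trans (cong (_* (+ k - + 1)) (sym (degree≡R point))) (degree-equation point))
      where
      rearrange : ∀ R k v → R * (k - + 1) ≡ v - + 1 → v ≡ R * (k - + 1) + + 1
      rearrange R k v eq = trans (+1-id v) (cong (_+ + 1) (sym eq))

    module EKR (S : Subset b) (ekr : IsErdősKoRado S) where

      σ : Fin b → ℤ
      σ B = 𝟙 (B ∈? S)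

      n : ℤ
      n = ∑ σ

      meet : ∀ {B C} → B ∈ S → C ∈ S → B ≢ C → ∑ (λ p → χ C p * χ B p) ≡ + 1
      meet {B} {C} B∈S C∈S B≢C =
        trans (∑-select _ p off) (cong₂ _*_ (𝟙-yes (p ∈? block C) p∈C) (𝟙-yes (p ∈? block B) p∈B))
        where
        p = proj₁ (ekr B∈S C∈S)
        p∈B = proj₁ (x∈p∩q⁻ (block B) (block C) (proj₂ (ekr B∈S C∈S)))
        p∈C = proj₂ (x∈p∩q⁻ (block B) (block C) (proj₂ (ekr B∈S C∈S)))
        off : ∀ q → q ≢ p → χ C q * χ B q ≡ 0ℤ
        off q q≢p = 𝟙-*-≡0 (q ∈? block C) (q ∈? block B) (λ (q∈C , q∈B) →
          B≢C (trans (sym (line-unique q≢p q∈B p∈B)) (line-unique q≢p q∈C p∈C)))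

      σ-meet : ∀ {C} → C ∈ S → ∀ B →
        σ B * ∑ (λ p → χ C p * χ B p) ≡ σ B * (+ 1 + (+ k - + 1) * 𝟙 (B ≟ C))
      σ-meet {C} C∈S B with B ∈? S | B ≟ C
      ... | no  _   | _        = refl
      ... | yes _   | yes refl = cong (+ 1 *_) (trans (∑-cong (λ p → 𝟙-idem (p ∈? block B))) (trans (∑-χ B) (id (+ k))))
        where
        id : ∀ k → k ≡ + 1 + (k - + 1) * + 1
        id = solve-∀
      ... | yes B∈S | no B≢C   = cong (+ 1 *_) (trans (meet B∈S C∈S B≢C) (id (+ k)))
        where
        id : ∀ k → + 1 ≡ + 1 + (k - + 1) * 0ℤ
        id = solve-∀

      load : (Fin b → ℤ) → Fin v → ℤ
      load f q = ∑ (λ B → (σ B * f B) * χ B q)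

      ∑-load : (f : Fin b → ℤ) → ∑ (load f) ≡ + k * ∑ (λ B → σ B * f B)
      ∑-load f = begin
        ∑ (load f)                                          ≡⟨ ∑-cong (λ q → *-identityˡ (load f q)) ⟨
        ∑ (λ q → + 1 * load f q)                            ≡⟨ ∑-exchange (λ _ → + 1) (λ q B → χ B q) (λ B → σ B * f B) ⟩
        ∑ (λ B → (σ B * f B) * ∑ (λ q → + 1 * χ B q))       ≡⟨ ∑-cong (λ B → trans (cong ((σ B * f B) *_) (trans (∑-cong (λ q → *-identityˡ _)) (∑-χ B))) (*-comm _ (+ k))) ⟩
        ∑ (λ B → + k * (σ B * f B))                         ≡⟨ *-∑ (+ k) _ ⟩
        + k * ∑ (λ B → σ B * f B)                           ∎

      block-load : ∀ {C} → C ∈ S → (f : Fin b → ℤ) →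
        ∑ (λ q → χ C q * load f q) ≡ ∑ (λ B → σ B * f B) + (+ k - + 1) * f C
      block-load {C} C∈S f = begin
        ∑ (λ q → χ C q * load f q)                                   ≡⟨ ∑-exchange (χ C) (λ q B → χ B q) (λ B → σ B * f B) ⟩
        ∑ (λ B → (σ B * f B) * ∑ (λ q → χ C q * χ B q))              ≡⟨ ∑-cong (λ B → swap (σ B) (f B) _ _ (σ-meet C∈S B)) ⟩
        ∑ (λ B → (σ B * f B) * (+ 1 + (+ k - + 1) * 𝟙 (B ≟ C)))      ≡⟨ ∑-affine _ (+ k - + 1) C ⟩
        ∑ (λ B → σ B * f B) + (+ k - + 1) * (σ C * f C)              ≡⟨ cong (λ x → ∑ (λ B → σ B * f B) + (+ k - + 1) * x) (trans (cong (_* f C) (𝟙-yes (C ∈? S) C∈S)) (*-identityˡ (f C))) ⟩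
        ∑ (λ B → σ B * f B) + (+ k - + 1) * f C                      ∎
        where
        reorder : ∀ a b c → (a * b) * c ≡ (a * c) * b
        reorder = solve-∀
        swap : ∀ a b c d → a * c ≡ a * d → (a * b) * c ≡ (a * b) * d
        swap a b c d eq = trans (reorder a b c) (trans (cong (_* b) eq) (sym (reorder a b d)))

      ∑-*-load : (g : Fin v → ℤ) (f : Fin b → ℤ) →
        ∑ (λ q → g q * load f q) ≡ ∑ (λ B → (σ B * f B) * ∑ (λ q → g q * χ B q))
      ∑-*-load g f = ∑-exchange g (λ q B → χ B q) (λ B → σ B * f B)

      -- This is k times the sum of (t - 1) (t - 2) over the blocks outside S.
      star-inequality : (τ : Fin v → ℤ) → (∀ p → τ p * τ p ≡ τ p) →
        (∀ {C} → C ∈ S → ∑ (λ p → τ p * χ C p) ≡ + k) → let w = ∑ τ in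
        0ℤ ≤ + 2 * (R * (R * (+ k - + 1) + + 1)) + + k * (w * (w - + 1) - + 2 * w * R) - n * (+ k * (+ k - + 1) * (+ k - + 2))
      star-inequality τ τ-idem t≡k = by (trans (collect (+ k) (+ b) n R w) final) (lit {k} · 0≤sum)
        where
        open Star τ τ-idem
        m = (+ k - + 1) * (+ k - + 2)
        term : Fin b → ℤ
        term C = t C * t C + (- + 3) * t C + (+ 2 * + 1 + (- m) * σ C)
        0≤term : ∀ C → 0ℤ ≤ term C
        0≤term C with C ∈? S
        ... | yes C∈S = by (id (+ k) (t C) (t≡k C∈S)) lit
          where
          id₀ : ∀ k → 0ℤ ≡ k * k + (- + 3) * k + (+ 2 * + 1 + (- ((k - + 1) * (k - + 2))) * + 1)
          id₀ = solve-∀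
          id : ∀ k t → t ≡ k → 0ℤ ≡ t * t + (- + 3) * t + (+ 2 * + 1 + (- ((k - + 1) * (k - + 2))) * + 1)
          id k _ refl = id₀ k
        ... | no _ = by (id (t C) (+ k)) (0≤consecutive (t C))
          where
          id : ∀ t k → (t - + 1) * (t - + 2) ≡ t * t + (- + 3) * t + (+ 2 * + 1 + (- ((k - + 1) * (k - + 2))) * 0ℤ)
          id = solve-∀
        ∑-term : ∑ term ≡ (w * w + (R - + 1) * w) + (- + 3) * (R * w) + (+ 2 * + b + (- m) * n)
        ∑-term = begin
          ∑ term ≡⟨ ∑-+ _ _ ⟩
          ∑ (λ C → t C * t C + (- + 3) * t C) + ∑ (λ C → + 2 * + 1 + (- m) * σ C) ≡⟨ cong₂ _+_ (∑-+ _ _) (∑-+ _ _) ⟩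
          (∑ (λ C → t C * t C) + ∑ (λ C → (- + 3) * t C)) + (∑ {b} (λ C → + 2 * + 1) + ∑ (λ C → (- m) * σ C))
            ≡⟨ cong₂ _+_ (cong₂ _+_ ∑-t² (trans (*-∑ (- + 3) t) (cong ((- + 3) *_) ∑-t)))
                 (cong₂ _+_ (trans (*-∑ (+ 2) (λ _ → + 1)) (cong (+ 2 *_) (∑-one b))) (*-∑ (- m) σ)) ⟩
          (w * w + (R - + 1) * w) + (- + 3) * (R * w) + (+ 2 * + b + (- m) * n) ∎
        0≤sum : 0ℤ ≤ (w * w + (R - + 1) * w) + (- + 3) * (R * w) + (+ 2 * + b + (- m) * n)
        0≤sum = by ∑-term (∑-0≤ 0≤term)
        final : + 2 * (+ k * + b) + + k * (w * (w - + 1) - + 2 * w * R) - n * (+ k * (+ k - + 1) * (+ k - + 2))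
          ≡ + 2 * (R * (R * (+ k - + 1) + + 1)) + + k * (w * (w - + 1) - + 2 * w * R) - n * (+ k * (+ k - + 1) * (+ k - + 2))
        final = cong (λ x → + 2 * x + + k * (w * (w - + 1) - + 2 * w * R) - n * (+ k * (+ k - + 1) * (+ k - + 2)))
          (trans k*b (trans (*-comm (+ v) R) (cong (R *_) v-equation)))

      d : Fin v → ℤ
      d = load (λ _ → + 1)

      d≡ : ∀ p → d p ≡ ∑ (λ B → σ B * χ B p)
      d≡ p = ∑-cong (λ B → cong (_* χ B p) (*-identityʳ (σ B)))

      σ*1 : ∑ (λ B → σ B * + 1) ≡ n
      σ*1 = ∑-cong (λ B → *-identityʳ (σ B))

      ∑-d : ∑ d ≡ + k * n
      ∑-d = trans (∑-load _) (cong (+ k *_) σ*1)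

      block-d : ∀ {C} → C ∈ S → ∑ (λ p → χ C p * d p) ≡ n + (+ k - + 1) * + 1
      block-d C∈S = trans (block-load C∈S _) (cong (_+ (+ k - + 1) * + 1) σ*1)

      ∑-d² : ∑ (λ p → d p * d p) ≡ n * (n + (+ k - + 1) * + 1)
      ∑-d² = begin
        ∑ (λ p → d p * d p)                                           ≡⟨ ∑-*-load d (λ _ → + 1) ⟩
        ∑ (λ B → (σ B * + 1) * ∑ (λ p → d p * χ B p))                 ≡⟨ ∑-cong step ⟩
        ∑ (λ B → (n + (+ k - + 1) * + 1) * (σ B * + 1))               ≡⟨ *-∑ (n + (+ k - + 1) * + 1) (λ B → σ B * + 1) ⟩
        (n + (+ k - + 1) * + 1) * ∑ (λ B → σ B * + 1)                 ≡⟨ cong ((n + (+ k - + 1) * + 1) *_) σ*1 ⟩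
        (n + (+ k - + 1) * + 1) * n                                   ≡⟨ *-comm (n + (+ k - + 1) * + 1) n ⟩
        n * (n + (+ k - + 1) * + 1)                                   ∎
        where
        step : ∀ B → (σ B * + 1) * ∑ (λ p → d p * χ B p) ≡ (n + (+ k - + 1) * + 1) * (σ B * + 1)
        step B with B ∈? S
        ... | yes B∈S = trans (cong (+ 1 * + 1 *_) (trans (∑-cong (λ p → *-comm (d p) (χ B p))) (block-d B∈S)))
                          (*-comm (+ 1 * + 1) _)
        ... | no _ = sym (*-zeroʳ (n + (+ k - + 1) * + 1))

      load-χ-self : ∀ p → load (λ B → χ B p) p ≡ d p
      load-χ-self p = trans (∑-cong (λ B → trans (*-assoc (σ B) _ _) (cong (σ B *_) (𝟙-idem (p ∈? block B))))) (sym (d≡ p))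

      load-χ-other : ∀ {p q} (p≢q : p ≢ q) → load (λ B → χ B p) q ≡ σ (line p≢q)
      load-χ-other p≢q = trans (∑-cong (λ B → *-assoc (σ B) _ _)) (∑-line p≢q σ)

      d≤k : ∀ {p C} → C ∈ S → ¬ (p ∈ block C) → d p ≤ + k
      d≤k {p} {C} C∈S p∉C = subst₂ _≤_ lower (∑-χ C) (∑-mono-≤ term)
        where
        lower : ∑ (λ q → χ C q * load (λ B → χ B p) q) ≡ d p
        lower = trans (block-load C∈S (λ B → χ B p))
          (trans (cong₂ (λ x y → x + (+ k - + 1) * y) (sym (d≡ p)) (𝟙-no (p ∈? block C) p∉C))
            (trans (cong (_+_ (d p)) (*-zeroʳ (+ k - + 1))) (+-identityʳ (d p))))
        term : ∀ q → χ C q * load (λ B → χ B p) q ≤ χ C q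
        term q with q ∈? block C
        ... | no _    = ≤-refl
        ... | yes q∈C = subst (_≤ + 1) (sym (trans (*-identityˡ _) (load-χ-other p≢q))) (0≤i-j⇒j≤i (0≤1-𝟙 (line p≢q ∈? S)))
          where
          p≢q : p ≢ q
          p≢q refl = p∉C q∈C

      -- τ is the indicator function of the union of the blocks of S through p.
      module Full (p : Fin v) (dp≡k : d p ≡ + k) where

        τ : Fin v → ℤ
        τ q = load (λ B → χ B p) q + (- (+ k - + 1)) * 𝟙 (q ≟ p)

        τ-idem : ∀ q → τ q * τ q ≡ τ q
        τ-idem q with q ≟ p
        ... | yes refl = trans (cong (λ x → x * x) one) (sym one)
          where
          id : ∀ k → k + (- (k - + 1)) * + 1 ≡ + 1
          id = solve-∀
          one : load (λ B → χ B q) q + (- (+ k - + 1)) * + 1 ≡ + 1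
          one = trans (cong (_+ (- (+ k - + 1)) * + 1) (trans (load-χ-self q) dp≡k)) (id (+ k))
        ... | no q≢p = trans (cong (λ x → x * x) eq) (trans (𝟙-idem (line p≢q ∈? S)) (sym eq))
          where
          p≢q : p ≢ q
          p≢q = q≢p ∘ sym
          eq : load (λ B → χ B p) q + (- (+ k - + 1)) * 0ℤ ≡ σ (line p≢q)
          eq = trans (cong (_+_ (load (λ B → χ B p) q)) (*-zeroʳ (- (+ k - + 1)))) (trans (+-identityʳ _) (load-χ-other p≢q))

        ∑-𝟙-point : (f : Fin v → ℤ) → ∑ (λ q → f q * 𝟙 (q ≟ p)) ≡ f p
        ∑-𝟙-point f = trans (∑-select _ p (λ q q≢p → trans (cong (f q *_) (𝟙-no (q ≟ p) q≢p)) (*-zeroʳ (f q))))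
          (trans (cong (f p *_) (𝟙-yes (p ≟ p) refl)) (*-identityʳ (f p)))

        ∑-τ : ∑ τ ≡ + k * (+ k - + 1) + + 1
        ∑-τ = begin
          ∑ τ                                                                        ≡⟨ ∑-+ _ _ ⟩
          ∑ (load (λ B → χ B p)) + ∑ (λ q → (- (+ k - + 1)) * 𝟙 (q ≟ p))             ≡⟨ cong₂ _+_ (trans (∑-load _) (cong (+ k *_) (trans (sym (d≡ p)) dp≡k))) (∑-𝟙-point (λ _ → - (+ k - + 1))) ⟩
          + k * + k + (- (+ k - + 1))                                                ≡⟨ id (+ k) ⟩
          + k * (+ k - + 1) + + 1                                                    ∎
          where
          id : ∀ k → k * k + (- (k - + 1)) ≡ k * (k - + 1) + + 1
          id = solve-∀

        t≡k : ∀ {C} → C ∈ S → ∑ (λ q → τ q * χ C q) ≡ + k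
        t≡k {C} C∈S = begin
          ∑ (λ q → τ q * χ C q)
            ≡⟨ ∑-cong (λ q → distribute (load (λ B → χ B p) q) (- (+ k - + 1)) (𝟙 (q ≟ p)) (χ C q)) ⟩
          ∑ (λ q → χ C q * load (λ B → χ B p) q + (- (+ k - + 1)) * (χ C q * 𝟙 (q ≟ p)))
            ≡⟨ ∑-+ _ _ ⟩
          ∑ (λ q → χ C q * load (λ B → χ B p) q) + ∑ (λ q → (- (+ k - + 1)) * (χ C q * 𝟙 (q ≟ p)))
            ≡⟨ cong₂ _+_ (trans (block-load C∈S _) (cong (_+ (+ k - + 1) * χ C p) (trans (sym (d≡ p)) dp≡k)))
                 (trans (*-∑ (- (+ k - + 1)) _) (cong ((- (+ k - + 1)) *_) (∑-𝟙-point (χ C)))) ⟩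
          (+ k + (+ k - + 1) * χ C p) + (- (+ k - + 1)) * χ C p
            ≡⟨ cancel (+ k) (χ C p) ⟩
          + k ∎
          where
          distribute : ∀ a c x y → (a + c * x) * y ≡ y * a + c * (y * x)
          distribute = solve-∀
          cancel : ∀ k x → (k + (k - + 1) * x) + (- (k - + 1)) * x ≡ k
          cancel = solve-∀

      module Sparse (d≤K : ∀ p → 0ℤ ≤ + k - + 1 - d p) (0<n : 0ℤ ≤ n - + 1) where
        K = + k - + 1
        δ = n - K * (K - + 1)

        deficiency : (f : Fin v → ℤ) → ∑ (λ p → f p * (K - d p)) ≡ K * ∑ f + (- + 1) * ∑ (λ p → f p * d p)
        deficiency f = begin
          ∑ (λ p → f p * (K - d p))                                 ≡⟨ ∑-cong (λ p → id (f p) K (d p)) ⟩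
          ∑ (λ p → K * f p + (- + 1) * (f p * d p))                 ≡⟨ ∑-+ _ _ ⟩
          ∑ (λ p → K * f p) + ∑ (λ p → (- + 1) * (f p * d p))       ≡⟨ cong₂ _+_ (*-∑ K f) (*-∑ (- + 1) _) ⟩
          K * ∑ f + (- + 1) * ∑ (λ p → f p * d p)                   ∎
          where
          id : ∀ a K d → a * (K - d) ≡ K * a + (- + 1) * (a * d)
          id = solve-∀

        0≤d : ∀ p → 0ℤ ≤ d p
        0≤d p = ∑-0≤ (λ B → 0≤𝟙 (B ∈? S) · lit {1} · 0≤𝟙 (p ∈? block B))

        δ≤K : 0ℤ ≤ K - δ
        δ≤K = cancel-0≤ n (K - δ) 0<n (by eq (∑-0≤ (λ p → 0≤d p · d≤K p)))
          where
          eq : ∑ (λ p → d p * (K - d p)) ≡ n * (K - δ)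
          eq = trans (deficiency d) (trans (cong₂ (λ x y → K * x + (- + 1) * y) ∑-d ∑-d²) (total-deficiency-id (+ k) n))

        δ≤d : ∀ {p C} → C ∈ S → p ∈ block C → 0ℤ ≤ d p - δ
        δ≤d {p} {C} C∈S p∈C = by (id K (d p) δ) (i≤j⇒0≤j-i (subst₂ _≤_ one eq (∑-term-≤ (λ q → 0≤𝟙 (q ∈? block C) · d≤K q) p)))
          where
          eq : ∑ (λ q → χ C q * (K - d q)) ≡ K - δ
          eq = trans (deficiency (χ C)) (trans (cong₂ (λ x y → K * x + (- + 1) * y) (∑-χ C) (block-d C∈S)) (block-deficiency-id (+ k) n))
          one : χ C p * (K - d p) ≡ K - d p
          one = trans (cong (_* (K - d p)) (𝟙-yes (p ∈? block C) p∈C)) (*-identityˡ (K - d p))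
          id : ∀ K d δ → (K - δ) - (K - d) ≡ d - δ
          id = solve-∀

        covered? : ∀ p → Dec (∃ λ C → C ∈ S × p ∈ block C)
        covered? p = any? (λ C → (C ∈? S) ×-dec (p ∈? block C))

        τ : Fin v → ℤ
        τ p = 𝟙 (covered? p)

        τd≡d : ∀ p → τ p * d p ≡ d p
        τd≡d p with covered? p
        ... | yes _ = *-identityˡ (d p)
        ... | no ¬c = sym (trans (d≡ p) (∑-zero uncovered))
          where
          uncovered : ∀ B → σ B * χ B p ≡ 0ℤ
          uncovered B = 𝟙-*-≡0 (B ∈? S) (p ∈? block B) (λ (B∈S , p∈B) → ¬c (B , B∈S , p∈B))

        t≡k : ∀ {C} → C ∈ S → ∑ (λ p → τ p * χ C p) ≡ + k
        t≡k {C} C∈S = trans (∑-cong step) (∑-χ C)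
          where
          step : ∀ p → τ p * χ C p ≡ χ C p
          step p with p ∈? block C
          ... | no _    = *-zeroʳ (τ p)
          ... | yes p∈C = trans (*-identityʳ (τ p)) (𝟙-yes (covered? p) (C , C∈S , p∈C))

        w = ∑ τ

        ∑-τd : ∑ (λ p → τ p * d p) ≡ + k * n
        ∑-τd = trans (∑-cong τd≡d) ∑-d

        lower : 0ℤ ≤ K * w - n * + k
        lower = by eq (∑-0≤ (λ p → 0≤𝟙 (covered? p) · d≤K p))
          where
          eq : ∑ (λ p → τ p * (K - d p)) ≡ K * w - n * + k
          eq = trans (deficiency τ) (trans (cong (λ x → K * w + (- + 1) * x) ∑-τd) (lower-id (+ k) n w))

        upper : 0ℤ ≤ K - + 1 → 0ℤ ≤ n - (w - n) * δ
        upper 1≤K = cancel-0≤ K (n - (w - n) * δ) 1≤K (by (trans (trans (∑-cong (λ p → cong (_* (K - d p)) (expand p))) eq) (upper-id (+ k) n w)) (∑-0≤ 0≤term))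
          where
          0≤term : ∀ p → 0ℤ ≤ (τ p * (d p - δ)) * (K - d p)
          0≤term p with covered? p
          ... | yes (C , C∈S , p∈C) = lit {1} · δ≤d C∈S p∈C · d≤K p
          ... | no _ = lit
          expand : ∀ p → τ p * (d p - δ) ≡ d p + (- δ) * τ p
          expand p = trans (id (τ p) (d p) δ) (cong (_+ (- δ) * τ p) (τd≡d p))
            where
            id : ∀ t d δ → t * (d - δ) ≡ t * d + (- δ) * t
            id = solve-∀
          ∑-f : ∑ (λ p → d p + (- δ) * τ p) ≡ + k * n + (- δ) * w
          ∑-f = trans (∑-+ _ _) (cong₂ _+_ ∑-d (*-∑ (- δ) τ))
          ∑-fd : ∑ (λ p → (d p + (- δ) * τ p) * d p) ≡ n * (n + K * + 1) + (- δ) * (+ k * n)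
          ∑-fd = trans (∑-cong (λ p → id (d p) (- δ) (τ p)))
            (trans (∑-+ _ _) (cong₂ _+_ ∑-d² (trans (*-∑ (- δ) _) (cong ((- δ) *_) ∑-τd))))
            where
            id : ∀ d x t → (d + x * t) * d ≡ d * d + x * (t * d)
            id = solve-∀
          eq : ∑ (λ p → (d p + (- δ) * τ p) * (K - d p))
            ≡ K * (+ k * n + (- δ) * w) + (- + 1) * (n * (n + K * + 1) + (- δ) * (+ k * n))
          eq = trans (deficiency _) (cong₂ (λ x y → K * x + (- + 1) * y) ∑-f ∑-fd)

        impossible : 0ℤ ≤ + k - + 4 → 0ℤ ≤ R - (+ k - + 1) * (+ k - + 2) →
          0ℤ ≤ + 16 * ((R - (+ k - + 1) * (+ k - + 2)) * (R - (+ k - + 1) * (+ k - + 2))) - + 9 * + k →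
          0ℤ ≤ n - R → ⊥
        impossible 4≤k 0≤ρ ρ-root R≤n =
          sparse-parameters (+ k) n R w 4≤k 0≤ρ ρ-root R≤n δ≤K (upper (by (K-1-id (+ k)) (4≤k ⊹ lit {2}))) lower
            (star-inequality τ (λ p → 𝟙-idem (covered? p)) t≡k)

  module _ {v k : ℕ} (𝓓 : Design v k) where
    open Design 𝓓
    open Counting 𝓓

    point : Fin v
    point = fromℕ< (ℕ.≤-<-trans ℕ.z≤n k<v)

    pencil : Fin v → Subset b
    pencil p = tabulate (λ B → does (p ∈? block B))

    ∈-pencil⁺ : ∀ {p B} → p ∈ block B → B ∈ pencil p
    ∈-pencil⁺ {p} {B} p∈B = lookup⇒[]= B (pencil p)
      (trans (lookup∘tabulate _ B) (dec-true (p ∈? block B) p∈B))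

    ∈-pencil⁻ : ∀ {p B} → B ∈ pencil p → p ∈ block B
    ∈-pencil⁻ {p} {B} B∈ = reflected (p ∈? block B) (trans (sym (lookup∘tabulate _ B)) ([]=⇒lookup B∈))
      where
      reflected : (P? : Dec (p ∈ block B)) → does P? ≡ inside → p ∈ block B
      reflected (yes p∈B) _ = p∈B

    degree≡∣pencil∣ : ∀ p → degree p ≡ + ∣ pencil p ∣
    degree≡∣pencil∣ p = trans (∑-cong agree) (∑-𝟙-∈ (pencil p))
      where
      agree : ∀ B → χ B p ≡ 𝟙 (B ∈? pencil p)
      agree B with p ∈? block B
      ... | yes p∈B = sym (𝟙-yes (B ∈? pencil p) (∈-pencil⁺ p∈B))
      ... | no  p∉B = sym (𝟙-no (B ∈? pencil p) (p∉B ∘ ∈-pencil⁻))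

    replication : ℕ
    replication = ∣ pencil point ∣

    ∣pencil∣ : ∀ p → ∣ pencil p ∣ ≡ replication
    ∣pencil∣ p = ℤ.+-injective (begin
      + ∣ pencil p ∣     ≡⟨ degree≡∣pencil∣ p ⟨
      degree p           ≡⟨ ℤ.*-cancelʳ-≡ (degree p) (degree point) (+ k - + 1) ⦃ k-1≢0 ⦄ (trans (degree-equation p) (sym (degree-equation point))) ⟩
      degree point       ≡⟨ degree≡∣pencil∣ point ⟩
      + replication      ∎)
      where
      open ≡-Reasoning
      k-1≢0 : NonZero (+ k - + 1)
      k-1≢0 = ≢-nonZero (λ k-1≡0 → ℕ.<⇒≢ 1<k (sym (ℤ.+-injective (ℤ.i-j≡0⇒i≡j (+ k) (+ 1) k-1≡0))))

    R : ℤ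
    R = + replication

    degree≡R : ∀ p → degree p ≡ R
    degree≡R p = trans (degree≡∣pencil∣ p) (cong +_ (∣pencil∣ p))

    open Regular 𝓓 R degree≡R point

    v∸1≡ : v ℕ.∸ 1 ≡ replication ℕ.* (k ℕ.∸ 1)
    v∸1≡ = ℤ.+-injective (begin
      + (v ℕ.∸ 1)                      ≡⟨ ℤ.⊖-≥ (ℕ.<⇒≤ (ℕ.<-trans 1<k k<v)) ⟨
      v ⊖ 1                            ≡⟨ ℤ.m-n≡m⊖n v 1 ⟨
      + v - + 1                        ≡⟨ degree-equation point ⟨
      degree point * (+ k - + 1)       ≡⟨ cong₂ _*_ (degree≡R point) (trans (ℤ.m-n≡m⊖n k 1) (ℤ.⊖-≥ (ℕ.<⇒≤ 1<k))) ⟩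
      R * + (k ℕ.∸ 1)                  ≡⟨ ℤ.pos-* replication (k ℕ.∸ 1) ⟨
      + (replication ℕ.* (k ℕ.∸ 1))    ∎)
      where open ≡-Reasoning

    module Bound (S : Subset b) (ekr : IsErdősKoRado S)
      (4≤k : 0ℤ ≤ + k - + 4)
      (R≤k²-k : 0ℤ ≤ + k * + k - + k - R)
      (0≤ρ : 0ℤ ≤ R - (+ k - + 1) * (+ k - + 2))
      (ρ-root : 0ℤ ≤ + 16 * ((R - (+ k - + 1) * (+ k - + 2)) * (R - (+ k - + 1) * (+ k - + 2))) - + 9 * + k)
      where
      open EKR S ekr

      n≡∣S∣ : n ≡ + ∣ S ∣
      n≡∣S∣ = ∑-𝟙-∈ S

      2≤ρ : 0ℤ ≤ R - (+ k - + 1) * (+ k - + 2) - + 2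
      2≤ρ = 2≤root (+ k - + 1) _ (by (K-3 (+ k)) 4≤k) 0≤ρ
        (subst (λ x → 0ℤ ≤ + 16 * ((R - (+ k - + 1) * (+ k - + 2)) * (R - (+ k - + 1) * (+ k - + 2))) - + 9 * x) (+1-id (+ k)) ρ-root)

      full-case : ∀ p → d p ≡ + k → 0ℤ ≤ n - R → n ≡ R × R ≡ + 8 × + k ≡ + 4
      full-case p dp≡k R≤n =
        full-parameters (+ k - + 4) (R - (+ k - + 1) * (+ k - + 2) - + 2) (n - R)
          (k≡ (+ k)) (R≡ (+ k) R) (n≡ R n) ∑-τ 4≤k 2≤ρ R≤n R≤k²-k
          (star-inequality τ τ-idem t≡k)
        where open Full p dp≡k

      1≤n : (∀ p → ∃ λ C → C ∈ S × ¬ (p ∈ block C)) → 0ℤ ≤ n - + 1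
      1≤n avoid = ℤ.i≤j⇒0≤j-i (subst (_≤ n) (𝟙-yes (C ∈? S) C∈S) (∑-term-≤ (λ B → 0≤𝟙 (B ∈? S)) C))
        where
        C = proj₁ (avoid point)
        C∈S = proj₁ (proj₂ (avoid point))

      sparse-case : (∀ p → ∃ λ C → C ∈ S × ¬ (p ∈ block C)) → (∀ p → d p ≢ + k) → 0ℤ ≤ n - R → ⊥
      sparse-case avoid d≢k R≤n = Sparse.impossible d≤K (1≤n avoid) 4≤k 0≤ρ ρ-root R≤n
        where
        reorder : ∀ k d → k - d - + 1 ≡ k - + 1 - d
        reorder = solve-∀
        d≤K : ∀ p → 0ℤ ≤ + k - + 1 - d p
        d≤K p = by (reorder (+ k) (d p)) (<⇒0≤-1 (ℤ.≤∧≢⇒<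
          (d≤k (proj₁ (proj₂ (avoid p))) (proj₂ (proj₂ (avoid p)))) (d≢k p)))

      non-pencil : (∀ p → ∃ λ C → C ∈ S × ¬ (p ∈ block C)) → 0ℤ ≤ n - R →
        n ≡ R × R ≡ + 8 × + k ≡ + 4
      non-pencil avoid R≤n with any? (λ p → d p ℤ.≟ + k)
      ... | yes (p , dp≡k) = full-case p dp≡k R≤n
      ... | no ∄p = ⊥-elim (sparse-case avoid (λ p dp≡k → ∄p (p , dp≡k)) R≤n)

      avoiding? : ∀ p → Dec (∃ λ C → C ∈ S × ¬ (p ∈ block C))
      avoiding? p = any? (λ C → (C ∈? S) ×-dec ¬? (p ∈? block C))

      pencil-or-avoiding : (∃ λ p → S ⊆ pencil p) ⊎ (∀ p → ∃ λ C → C ∈ S × ¬ (p ∈ block C))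
      pencil-or-avoiding with all? avoiding?
      ... | yes avoid = inj₂ avoid
      ... | no ¬avoid = inj₁ (p , contained)
        where
        cex : ∃ λ p → ¬ (∃ λ C → C ∈ S × ¬ (p ∈ block C))
        cex = ¬∀⟶∃¬ v _ avoiding? ¬avoid
        p = proj₁ cex
        contained : S ⊆ pencil p
        contained {C} C∈S with p ∈? block C
        ... | yes p∈C = ∈-pencil⁺ p∈C
        ... | no  p∉C = ⊥-elim (proj₂ cex (C , C∈S , p∉C))

      IsPointPencil-size : IsPointPencil S → ∣ S ∣ ≡ replication
      IsPointPencil-size (p , S⇔p) = trans (ℕ.≤-antisym
        (p⊆q⇒∣p∣≤∣q∣ (λ {B} B∈S → ∈-pencil⁺ (Equivalence.to (S⇔p B) B∈S)))
        (p⊆q⇒∣p∣≤∣q∣ (λ {B} B∈p → Equivalence.from (S⇔p B) (∈-pencil⁻ {p} B∈p)))) (∣pencil∣ p)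

      full-pencil : ∀ {p} → S ⊆ pencil p → ∣ S ∣ ≡ replication → IsPointPencil S
      full-pencil {p} S⊆p ∣S∣≡r = p , λ B → mk⇔ (∈-pencil⁻ {p} ∘ S⊆p) (back B)
        where
        back : ∀ B → p ∈ block B → B ∈ S
        back B p∈B with B ∈? S
        ... | yes B∈S = B∈S
        ... | no  B∉S = ⊥-elim (ℕ.<⇒≢ (p⊂q⇒∣p∣<∣q∣ (S⊆p , B , ∈-pencil⁺ p∈B , B∉S)) (trans ∣S∣≡r (sym (∣pencil∣ p))))

      non-pencilℕ : (∀ p → ∃ λ C → C ∈ S × ¬ (p ∈ block C)) → replication ℕ.≤ ∣ S ∣ →
        ∣ S ∣ ≡ replication × replication ≡ 8 × k ≡ 4
      non-pencilℕ avoid R≤∣S∣ with non-pencil avoid (ℤ.i≤j⇒0≤j-i (subst (R ≤_) (sym n≡∣S∣) (+≤+ R≤∣S∣)))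
      ... | n≡R , R≡8 , k≡4 = ℤ.+-injective (trans (sym n≡∣S∣) n≡R) , ℤ.+-injective R≡8 , ℤ.+-injective k≡4

      size-bound : ∣ S ∣ ℕ.≤ replication
      size-bound with pencil-or-avoiding
      ... | inj₁ (p , S⊆p) = subst (∣ S ∣ ℕ.≤_) (∣pencil∣ p) (p⊆q⇒∣p∣≤∣q∣ S⊆p)
      ... | inj₂ avoid with ℕ.≤-total ∣ S ∣ replication
      ...   | inj₁ ∣S∣≤r = ∣S∣≤r
      ...   | inj₂ r≤∣S∣ = ℕ.≤-reflexive (proj₁ (non-pencilℕ avoid r≤∣S∣))

      equality-case : ∣ S ∣ ≡ replication → IsPointPencil S ⊎ (replication ≡ 8 × k ≡ 4)
      equality-case ∣S∣≡r with pencil-or-avoiding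
      ... | inj₁ (p , S⊆p) = inj₁ (full-pencil {p} S⊆p ∣S∣≡r)
      ... | inj₂ avoid = inj₂ (proj₂ (non-pencilℕ avoid (ℕ.≤-reflexive (sym ∣S∣≡r))))

module Rationals where
  open import Defs
  open import Algebra.Bundles using (CommutativeMonoid)
  import Algebra.Properties.CommutativeSemigroup as CommutativeSemigroupProperties
  open import Data.Integer.Base as ℤ using (+_; +0; +[1+_]; -[1+_]; 0ℤ)
  import Data.Integer.Properties as ℤ
  open import Data.Integer.Tactic.RingSolver using (solve-∀)
  open import Data.Nat.Base as ℕ using (ℕ)
  open import Data.Product using (_×_; _,_)
  open import Data.Rational.Base using (0ℚ; _/_; _+_; _-_; _*_; -_; _≤_; *≤*; nonNegative)
  open import Data.Rational.Literals using (fromℤ)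
  import Data.Rational.Properties as ℚ
  open import Data.Rational.Unnormalised.Base using (mkℚᵘ; *≡*)
  import Data.Rational.Unnormalised.Properties as ℚᵘ
  open import Relation.Binary.PropositionalEquality

  fromℤ-+ : ∀ a b → fromℤ a + fromℤ b ≡ fromℤ (a ℤ.+ b)
  fromℤ-+ a b = ℚ.toℚᵘ-injective (ℚᵘ.≃-trans (ℚ.toℚᵘ-homo-+ (fromℤ a) (fromℤ b)) (*≡* (id a b)))
    where
    id : ∀ a b → (a ℤ.* + 1 ℤ.+ b ℤ.* + 1) ℤ.* + 1 ≡ (a ℤ.+ b) ℤ.* (+ 1 ℤ.* + 1)
    id = solve-∀

  fromℤ-* : ∀ a b → fromℤ a * fromℤ b ≡ fromℤ (a ℤ.* b)
  fromℤ-* a b = ℚ.toℚᵘ-injective (ℚᵘ.≃-trans (ℚ.toℚᵘ-homo-* (fromℤ a) (fromℤ b)) (*≡* (id a b)))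
    where
    id : ∀ a b → a ℤ.* b ℤ.* + 1 ≡ a ℤ.* b ℤ.* (+ 1 ℤ.* + 1)
    id = solve-∀

  fromℤ-neg : ∀ a → - fromℤ a ≡ fromℤ (ℤ.- a)
  fromℤ-neg +0       = refl
  fromℤ-neg +[1+ _ ] = refl
  fromℤ-neg -[1+ _ ] = refl

  fromℤ-- : ∀ a b → fromℤ a - fromℤ b ≡ fromℤ (a ℤ.- b)
  fromℤ-- a b = trans (cong (_+_ (fromℤ a)) (fromℤ-neg b)) (fromℤ-+ a (ℤ.- b))

  fromℤ-cancel-≤ : ∀ {a b} → fromℤ a ≤ fromℤ b → a ℤ.≤ b
  fromℤ-cancel-≤ {a} {b} a≤b = subst₂ ℤ._≤_ (ℤ.*-identityʳ a) (ℤ.*-identityʳ b) (ℚ.drop-*≤* a≤b)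

  fromℤ-mono-≤ : ∀ {a b} → a ℤ.≤ b → fromℤ a ≤ fromℤ b
  fromℤ-mono-≤ {a} {b} a≤b = *≤* (subst₂ ℤ._≤_ (sym (ℤ.*-identityʳ a)) (sym (ℤ.*-identityʳ b)) a≤b)

  fromℕ-injective : ∀ {m n} → fromℕ m ≡ fromℕ n → m ≡ n
  fromℕ-injective refl = refl

  /≡fromℕ : ∀ m q d .⦃ _ : ℕ.NonZero d ⦄ → m ≡ q ℕ.* d → + m / d ≡ fromℕ q
  /≡fromℕ m q d@(ℕ.suc d-1) eq = ℚ.toℚᵘ-injective (ℚᵘ.≃-trans (ℚ.toℚᵘ-fromℚᵘ (mkℚᵘ (+ m) d-1))
    (*≡* (trans (ℤ.*-identityʳ (+ m)) (trans (cong +_ eq) (ℤ.pos-* q d)))))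

  root-bound : ∀ k s R → s ≥√ k →
    fromℕ k * fromℕ k - fromℕ 3 * fromℕ k + (+ 3 / 4) * s + fromℕ 2 ≤ fromℤ R →
    let ρ = R ℤ.- (+ k ℤ.- + 1) ℤ.* (+ k ℤ.- + 2) in
    0ℤ ℤ.≤ ρ × 0ℤ ℤ.≤ + 16 ℤ.* (ρ ℤ.* ρ) ℤ.- + 9 ℤ.* + k
  root-bound k s R (0≤s , k≤s²) hyp = fromℤ-cancel-≤ (ℚ.≤-trans 0≤x x≤ρ) , ℤ.i≤j⇒0≤j-i (fromℤ-cancel-≤ 9k≤16ρ²)
    where
    x = (+ 3 / 4) * s
    ρ = R ℤ.- (+ k ℤ.- + 1) ℤ.* (+ k ℤ.- + 2)
    m = + k ℤ.* + k ℤ.- + 3 ℤ.* + k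
    0≤x : 0ℚ ≤ x
    0≤x = subst (_≤ x) (ℚ.*-zeroʳ (+ 3 / 4)) (ℚ.*-monoˡ-≤-nonNeg (+ 3 / 4) 0≤s)
    m≡ : fromℕ k * fromℕ k - fromℕ 3 * fromℕ k ≡ fromℤ m
    m≡ = trans (cong₂ _-_ (fromℤ-* (+ k) (+ k)) (fromℤ-* (+ 3) (+ k))) (fromℤ-- (+ k ℤ.* + k) (+ 3 ℤ.* + k))
    hyp′ : x + fromℤ (m ℤ.+ + 2) ≤ fromℤ R
    hyp′ = subst (_≤ fromℤ R) (begin
      fromℕ k * fromℕ k - fromℕ 3 * fromℕ k + x + fromℕ 2   ≡⟨ cong (λ y → y + x + fromℕ 2) m≡ ⟩
      fromℤ m + x + fromℕ 2                                 ≡⟨ cong (_+ fromℕ 2) (ℚ.+-comm (fromℤ m) x) ⟩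
      x + fromℤ m + fromℕ 2                                 ≡⟨ ℚ.+-assoc x (fromℤ m) (fromℕ 2) ⟩
      x + (fromℤ m + fromℕ 2)                               ≡⟨ cong (_+_ x) (fromℤ-+ m (+ 2)) ⟩
      x + fromℤ (m ℤ.+ + 2)                                 ∎) hyp
      where open ≡-Reasoning
    x≤ρ : x ≤ fromℤ ρ
    x≤ρ = subst₂ _≤_
      (begin
        x + fromℤ (m ℤ.+ + 2) + fromℤ (ℤ.- (m ℤ.+ + 2))     ≡⟨ ℚ.+-assoc x _ _ ⟩
        x + (fromℤ (m ℤ.+ + 2) + fromℤ (ℤ.- (m ℤ.+ + 2)))   ≡⟨ cong (_+_ x) (trans (fromℤ-+ (m ℤ.+ + 2) _) (cong fromℤ (ℤ.+-inverseʳ (m ℤ.+ + 2)))) ⟩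
        x + 0ℚ                                              ≡⟨ ℚ.+-identityʳ x ⟩
        x                                                   ∎)
      (trans (fromℤ-+ R (ℤ.- (m ℤ.+ + 2))) (cong fromℤ (id (+ k) R)))
      (ℚ.+-monoˡ-≤ (fromℤ (ℤ.- (m ℤ.+ + 2))) hyp′)
      where
      open ≡-Reasoning
      id : ∀ k R → R ℤ.+ ℤ.- (k ℤ.* k ℤ.- + 3 ℤ.* k ℤ.+ + 2) ≡ R ℤ.- (k ℤ.- + 1) ℤ.* (k ℤ.- + 2)
      id = solve-∀
    x²≤ρ² : x * x ≤ fromℤ (ρ ℤ.* ρ)
    x²≤ρ² = subst (x * x ≤_) (fromℤ-* ρ ρ) (ℚ.≤-trans
      (ℚ.*-monoˡ-≤-nonNeg x ⦃ nonNegative 0≤x ⦄ x≤ρ)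
      (ℚ.*-monoʳ-≤-nonNeg (fromℤ ρ) ⦃ nonNegative (ℚ.≤-trans 0≤x x≤ρ) ⦄ x≤ρ))
    9/16k≤x² : (+ 9 / 16) * fromℕ k ≤ x * x
    9/16k≤x² = subst ((+ 9 / 16) * fromℕ k ≤_) (interchange (+ 3 / 4) (+ 3 / 4) s s)
      (ℚ.*-monoˡ-≤-nonNeg (+ 9 / 16) k≤s²)
      where open CommutativeSemigroupProperties (CommutativeMonoid.commutativeSemigroup ℚ.*-1-commutativeMonoid) using (interchange)
    9k≤16ρ² : fromℤ (+ 9 ℤ.* + k) ≤ fromℤ (+ 16 ℤ.* (ρ ℤ.* ρ))
    9k≤16ρ² = subst₂ _≤_
      (trans (sym (ℚ.*-assoc (fromℕ 16) (+ 9 / 16) (fromℕ k))) (fromℤ-* (+ 9) (+ k)))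
      (fromℤ-* (+ 16) (ρ ℤ.* ρ))
      (ℚ.*-monoˡ-≤-nonNeg (fromℕ 16) (ℚ.≤-trans 9/16k≤x² x²≤ρ²))

open import Defs
open import Data.Fin.Subset using (Subset; ∣_∣)
open import Data.Integer.Base using (+_)
open import Data.Nat.Base using (ℕ) renaming (_≥_ to _≥ℕ_)
open import Data.Product using (_×_; _,_; ∃)
open import Data.Rational.Base using (ℚ; _/_; _+_; _-_; _*_; _≤_; _≥_)
open import Function.Bundles using (_⇔_)
open import Relation.Binary.PropositionalEquality using (_≡_; _≢_)

open import Data.Empty using (⊥-elim)
import Data.Integer.Base as ℤ
import Data.Integer.Properties as ℤ
import Data.Nat.Base as ℕ
import Data.Nat.Properties as ℕ
open import Data.Product using (proj₁; proj₂)
open import Data.Sum.Base using ([_,_]′)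
open import Function.Base using (id)
open import Function.Bundles using (mk⇔)
open import Relation.Binary.PropositionalEquality using (refl; sym; trans; cong; cong₂; subst; subst₂)

theorem5p5 : ∀ {v k : ℕ} (𝓓 : Design v k) (S : Subset (Design.b 𝓓)) →
    let open Design 𝓓
        κ = fromℕ k
    in
    k ≥ℕ 4 →
    IsErdősKoRado S →
    κ * κ - κ ≥ r →
    (∃ λ (s : ℚ) → s ≥√ k × r ≥ κ * κ - fromℕ 3 * κ + (+ 3 / 4) * s + fromℕ 2) →
    fromℕ ∣ S ∣ ≤ r ×
    ((r , k) ≢ (fromℕ 8 , 4) → (fromℕ ∣ S ∣ ≡ r ⇔ IsPointPencil S))
theorem5p5 {v} {k} 𝓓 S k≥4 ekr r≤κ²-κ (s , s≥√k , lower) =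
  subst (fromℕ ∣ S ∣ ≤_) (sym r≡) (fromℤ-mono-≤ (ℤ.+≤+ size-bound)) ,
  λ rk≢ → mk⇔
    (λ ∣S∣≡r → [ id , (λ (R≡8 , k≡4) → ⊥-elim (rk≢ (cong₂ _,_ (trans r≡ (cong fromℕ R≡8)) k≡4))) ]′
      (equality-case (fromℕ-injective (trans ∣S∣≡r r≡))))
    (λ pencil → trans (cong fromℕ (IsPointPencil-size pencil)) (sym r≡))
  where
  open Design 𝓓
  open Rationals
  open Designs using (replication; v∸1≡)
  R = replication 𝓓
  r≡ : r ≡ fromℕ R
  r≡ = /≡fromℕ (v ℕ.∸ 1) R (k ℕ.∸ 1) ⦃ ℕ.>-nonZero (ℕ.m<n⇒0<n∸m 1<k) ⦄ (v∸1≡ 𝓓)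
  κ²-κ≡ : fromℕ k * fromℕ k - fromℕ k ≡ _
  κ²-κ≡ = trans (cong (_- fromℕ k) (fromℤ-* (+ k) (+ k))) (fromℤ-- (+ k ℤ.* + k) (+ k))
  ρ-bounds = root-bound k s (+ R) s≥√k (subst (_ ≤_) r≡ lower)
  open Designs.Bound 𝓓 S ekr (ℤ.i≤j⇒0≤j-i (ℤ.+≤+ k≥4))
    (ℤ.i≤j⇒0≤j-i (fromℤ-cancel-≤ (subst₂ _≤_ r≡ κ²-κ≡ r≤κ²-κ)))
    (proj₁ ρ-bounds) (proj₂ ρ-bounds)
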